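{- Let $G$ be a simple graph with $n$ vertices and $m$ edges such that $n\leq m\leq \frac{\sqrt{3}-1}{4}(n-1)n$. Then for every natural number $k$ in the interval $\left[\sqrt[3]{\frac{8m^{2}}{n-1}+4mn+n^{2}},\; n\right]$ one has $$S_{k}(G)\leq m+\binom{k+1}{2}.$$
   Context: For a simple graph $G$ on $n$ vertices, the Laplacian matrix is the $n\times n$ matrix $L(G)=D(G)-A(G)$, where $D(G)$ is the diagonal matrix of vertex degrees and $A(G)$ is the adjacency matrix. Its eigenvalues, listed with multiplicity in decreasing order, are the nonnegative reals $\mu_{1}(G)\geq \mu_{2}(G)\geq\cdots\geq\mu_{n}(G)=0$. For $1\leq k\leq n$, $S_{k}(G)=\sum_{i=1}^{k}\mu_{i}(G)$. Brouwer's conjecture for $G$ and $k$ is the inequality $S_{k}(G)\leq m+\binom{k+1}{2}$, where $m$ is the number of edges of $G$. -}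

module Defs where

open import Level using (0ℓ)
open import Algebra.Bundles using (CommutativeRing)
open import Algebra.Bundles.Raw using (RawRing)
open import Data.Bool.Base using (if_then_else_; _∧_)
open import Data.Fin.Base as Fin using (Fin; zero; suc; toℕ; punchIn; inject≤)
open import Data.Fin.Properties as Fin using ()
open import Data.Integer.Base as ℤ using (ℤ; +_)
open import Data.Nat.Base as ℕ using (ℕ; zero; suc)
open import Data.Nat.Properties as ℕ using ()
open import Data.Product.Base using (_×_; _,_; ∃-syntax)
open import Data.Rational.Base as ℚ using (ℚ; 0ℚ; 1ℚ; ½; ∣_∣; _<_; Positive; positive)
open import Data.Rational.Properties as ℚ using ()
open import Data.Vec.Functional using (Vector)
open import Relation.Binary.Core using (Rel)
open import Relation.Binary.Definitions using (Symmetric; Decidable)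
open import Relation.Binary.PropositionalEquality using (_≡_; sym; trans; cong; cong₂; subst; module ≡-Reasoning)
open import Relation.Nullary using (¬_)
open import Relation.Nullary.Decidable using (does)
import Algebra.Definitions.RawMonoid
import Algebra.Definitions.RawSemiring

Cauchy : (ℕ → ℚ) → Set
Cauchy x = ∀ ε → 0ℚ < ε → ∃[ N ] (∀ i j → N ℕ.≤ i → N ℕ.≤ j → ∣ x i ℚ.- x j ∣ < ε)

record ℝ : Set where
  constructor mkℝ
  field
    seq    : ℕ → ℚ
    cauchy : Cauchy seq

open ℝ public

infix 4 _≈ℝ_ _≤ℝ_

record _≈ℝ_ (x y : ℝ) : Set where
  constructor mk≈
  field
    close : ∀ ε → 0ℚ < ε → ∃[ N ] (∀ i → N ℕ.≤ i → ∣ seq x i ℚ.- seq y i ∣ < ε)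

record _≤ℝ_ (x y : ℝ) : Set where
  constructor mk≤
  field
    below : ∀ ε → 0ℚ < ε → ∃[ N ] (∀ i → N ℕ.≤ i → seq x i < seq y i ℚ.+ ε)

open _≈ℝ_ public
open _≤ℝ_ public

fromℚ : ℚ → ℝ
fromℚ q = mkℝ (λ _ → q) λ ε 0<ε →
  0 , λ _ _ _ _ → subst (_< ε) (cong ∣_∣ (sym (ℚ.+-inverseʳ q))) 0<ε

fromℤ : ℤ → ℝ
fromℤ z = fromℚ (z ℚ./ 1)

fromℕ : ℕ → ℝ
fromℕ n = fromℤ (+ n)

private
  open import Algebra.Properties.CommutativeSemigroup
    (CommutativeRing.+-commutativeSemigroup ℚ.+-*-commutativeRing) using (interchange)
  open import Algebra.Properties.Ring ℚ.+-*-ring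
    using (x[y-z]≈xy-xz; [y-z]x≈yx-zx)
  open import Algebra.Properties.Group ℚ.+-0-group using () renaming (//-rightDividesˡ to x//y∙y≈x)

  -- Abstract, since unfolding these moduli makes type checking of det intractable.
  abstract
    half-pos : ∀ {ε} → 0ℚ < ε → 0ℚ < ½ ℚ.* ε
    half-pos 0<ε = ℚ.*-monoʳ-<-pos ½ 0<ε

    half+half : ∀ ε → ½ ℚ.* ε ℚ.+ ½ ℚ.* ε ≡ ε
    half+half ε = trans (sym (ℚ.*-distribʳ-+ ε ½ ½)) (ℚ.*-identityˡ ε)

    +-difference : ∀ a b c d → (a ℚ.+ b) ℚ.- (c ℚ.+ d) ≡ (a ℚ.- c) ℚ.+ (b ℚ.- d)
    +-difference a b c d = trans (cong (a ℚ.+ b ℚ.+_) (ℚ.neg-distrib-+ c d))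
                                 (interchange a b (ℚ.- c) (ℚ.- d))

    *-difference : ∀ a b c d → a ℚ.* b ℚ.- c ℚ.* d ≡ a ℚ.* (b ℚ.- d) ℚ.+ (a ℚ.- c) ℚ.* d
    *-difference a b c d = sym (begin
      a ℚ.* (b ℚ.- d) ℚ.+ (a ℚ.- c) ℚ.* d
        ≡⟨ cong₂ ℚ._+_ (x[y-z]≈xy-xz a b d) ([y-z]x≈yx-zx d a c) ⟩
      (a ℚ.* b ℚ.- a ℚ.* d) ℚ.+ (a ℚ.* d ℚ.- c ℚ.* d)
        ≡⟨ ℚ.+-assoc (a ℚ.* b ℚ.- a ℚ.* d) (a ℚ.* d) (ℚ.- (c ℚ.* d)) ⟨
      (a ℚ.* b ℚ.- a ℚ.* d) ℚ.+ a ℚ.* d ℚ.- c ℚ.* d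
        ≡⟨ cong (ℚ._- c ℚ.* d) (x//y∙y≈x (a ℚ.* d) (a ℚ.* b)) ⟩
      a ℚ.* b ℚ.- c ℚ.* d ∎)
      where open ≡-Reasoning

    +-cauchy : ∀ {x y} → Cauchy x → Cauchy y → Cauchy (λ i → x i ℚ.+ y i)
    +-cauchy {x} {y} cx cy ε 0<ε with cx (½ ℚ.* ε) (half-pos 0<ε) | cy (½ ℚ.* ε) (half-pos 0<ε)
    ... | M , hx | N , hy = M ℕ.⊔ N , λ i j p q → begin-strict
      ∣ (x i ℚ.+ y i) ℚ.- (x j ℚ.+ y j) ∣
        ≡⟨ cong ∣_∣ (+-difference (x i) (y i) (x j) (y j)) ⟩
      ∣ (x i ℚ.- x j) ℚ.+ (y i ℚ.- y j) ∣
        ≤⟨ ℚ.∣p+q∣≤∣p∣+∣q∣ (x i ℚ.- x j) (y i ℚ.- y j) ⟩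
      ∣ x i ℚ.- x j ∣ ℚ.+ ∣ y i ℚ.- y j ∣
        <⟨ ℚ.+-mono-< (hx i j (ℕ.m⊔n≤o⇒m≤o M N p) (ℕ.m⊔n≤o⇒m≤o M N q))
                      (hy i j (ℕ.m⊔n≤o⇒n≤o M N p) (ℕ.m⊔n≤o⇒n≤o M N q)) ⟩
      ½ ℚ.* ε ℚ.+ ½ ℚ.* ε
        ≡⟨ half+half ε ⟩
      ε ∎
      where open ℚ.≤-Reasoning

    neg-cauchy : ∀ {x} → Cauchy x → Cauchy (λ i → ℚ.- x i)
    neg-cauchy {x} cx ε 0<ε with cx ε 0<ε
    ... | N , hx = N , λ i j p q → subst (_< ε) (eq i j) (hx i j p q)
      where
      eq : ∀ i j → ∣ x i ℚ.- x j ∣ ≡ ∣ ℚ.- x i ℚ.- (ℚ.- x j) ∣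
      eq i j = trans (sym (ℚ.∣-p∣≡∣p∣ (x i ℚ.- x j)))
                     (cong ∣_∣ (ℚ.neg-distrib-+ (x i) (ℚ.- x j)))

    EventuallyBounded : (ℕ → ℚ) → Set
    EventuallyBounded x = ∃[ B ] (0ℚ < B × ∃[ N ] (∀ i → N ℕ.≤ i → ∣ x i ∣ ℚ.≤ B))

    bounded : ∀ {x} → Cauchy x → EventuallyBounded x
    bounded {x} cx with cx 1ℚ (ℚ.positive⁻¹ 1ℚ)
    ... | N , hx = 1ℚ ℚ.+ ∣ x N ∣ , ℚ.+-mono-<-≤ (ℚ.positive⁻¹ 1ℚ) (ℚ.0≤∣p∣ (x N)) , N , λ i p →
      begin
        ∣ x i ∣
          ≡⟨ cong ∣_∣ (sym (x//y∙y≈x (x N) (x i))) ⟩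
        ∣ (x i ℚ.- x N) ℚ.+ x N ∣
          ≤⟨ ℚ.∣p+q∣≤∣p∣+∣q∣ (x i ℚ.- x N) (x N) ⟩
        ∣ x i ℚ.- x N ∣ ℚ.+ ∣ x N ∣
          ≤⟨ ℚ.+-monoˡ-≤ ∣ x N ∣ (ℚ.<⇒≤ (hx i N p ℕ.≤-refl)) ⟩
        1ℚ ℚ.+ ∣ x N ∣ ∎
      where
      open ℚ.≤-Reasoning

    scaled : ∀ {B ε} → 0ℚ < B → 0ℚ < ε → ∃[ δ ] (0ℚ < δ × B ℚ.* δ ≡ ε)
    scaled {B} {ε} 0<B 0<ε = δ , ℚ.positive⁻¹ δ , eq
      where
      instance
        B-pos : Positive B
        B-pos = positive 0<B
        ε-pos : Positive ε
        ε-pos = positive 0<ε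
        B≢0 : ℚ.NonZero B
        B≢0 = ℚ.pos⇒nonZero B
        1/B-pos : Positive (ℚ.1/ B)
        1/B-pos = ℚ.1/pos⇒pos B
      δ : ℚ
      δ = ℚ.1/ B ℚ.* ε
      instance
        δ-pos : Positive δ
        δ-pos = ℚ.pos*pos⇒pos (ℚ.1/ B) ε
      eq : B ℚ.* δ ≡ ε
      eq = trans (sym (ℚ.*-assoc B (ℚ.1/ B) ε))
             (trans (cong (ℚ._* ε) (ℚ.*-inverseʳ B)) (ℚ.*-identityˡ ε))

    ∣p∣*∣q∣< : ∀ {p q B δ ε} → 0ℚ < B → ∣ p ∣ ℚ.≤ B → ∣ q ∣ < δ → B ℚ.* δ ≡ ε → ∣ p ∣ ℚ.* ∣ q ∣ < ε
    ∣p∣*∣q∣< {p} {q} {B} {δ} {ε} 0<B p≤B q<δ eq = begin-strict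
      ∣ p ∣ ℚ.* ∣ q ∣  ≤⟨ ℚ.*-monoʳ-≤-nonNeg ∣ q ∣ {{ℚ.∣-∣-nonNeg q}} p≤B ⟩
      B ℚ.* ∣ q ∣      <⟨ ℚ.*-monoʳ-<-pos B {{positive 0<B}} q<δ ⟩
      B ℚ.* δ          ≡⟨ eq ⟩
      ε                ∎
      where open ℚ.≤-Reasoning

    *-difference-< : ∀ a b c d {B C γ δ ε} → 0ℚ < B → 0ℚ < C → ∣ a ∣ ℚ.≤ B → ∣ d ∣ ℚ.≤ C →
                     ∣ b ℚ.- d ∣ < δ → ∣ a ℚ.- c ∣ < γ → B ℚ.* δ ≡ ½ ℚ.* ε → C ℚ.* γ ≡ ½ ℚ.* ε →
                     ∣ a ℚ.* b ℚ.- c ℚ.* d ∣ < ε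
    *-difference-< a b c d {ε = ε} 0<B 0<C a≤B d≤C b-d<δ a-c<γ Bδ≡ Cγ≡ = begin-strict
      ∣ a ℚ.* b ℚ.- c ℚ.* d ∣
        ≡⟨ cong ∣_∣ (*-difference a b c d) ⟩
      ∣ a ℚ.* (b ℚ.- d) ℚ.+ (a ℚ.- c) ℚ.* d ∣
        ≤⟨ ℚ.∣p+q∣≤∣p∣+∣q∣ (a ℚ.* (b ℚ.- d)) ((a ℚ.- c) ℚ.* d) ⟩
      ∣ a ℚ.* (b ℚ.- d) ∣ ℚ.+ ∣ (a ℚ.- c) ℚ.* d ∣
        ≡⟨ cong₂ ℚ._+_ (ℚ.∣p*q∣≡∣p∣*∣q∣ a (b ℚ.- d))
                       (trans (ℚ.∣p*q∣≡∣p∣*∣q∣ (a ℚ.- c) d) (ℚ.*-comm ∣ a ℚ.- c ∣ ∣ d ∣)) ⟩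
      ∣ a ∣ ℚ.* ∣ b ℚ.- d ∣ ℚ.+ ∣ d ∣ ℚ.* ∣ a ℚ.- c ∣
        <⟨ ℚ.+-mono-< (∣p∣*∣q∣< {a} {b ℚ.- d} 0<B a≤B b-d<δ Bδ≡)
                      (∣p∣*∣q∣< {d} {a ℚ.- c} 0<C d≤C a-c<γ Cγ≡) ⟩
      ½ ℚ.* ε ℚ.+ ½ ℚ.* ε
        ≡⟨ half+half ε ⟩
      ε ∎
      where open ℚ.≤-Reasoning

    *-cauchy : ∀ {x y} → Cauchy x → Cauchy y → Cauchy (λ i → x i ℚ.* y i)
    *-cauchy {x} {y} cx cy ε 0<ε = go (bounded {x} cx) (bounded {y} cy)
      where
      Claim : Set
      Claim = ∃[ N ] (∀ i j → N ℕ.≤ i → N ℕ.≤ j → ∣ x i ℚ.* y i ℚ.- x j ℚ.* y j ∣ < ε)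
      go : EventuallyBounded x → EventuallyBounded y → Claim
      go (B , 0<B , M₁ , x≤B) (C , 0<C , N₁ , y≤C) =
        go₂ (scaled 0<C (half-pos 0<ε)) (scaled 0<B (half-pos 0<ε))
        where
        go₂ : ∃[ γ ] (0ℚ < γ × C ℚ.* γ ≡ ½ ℚ.* ε) → ∃[ δ ] (0ℚ < δ × B ℚ.* δ ≡ ½ ℚ.* ε) → Claim
        go₂ (γ , 0<γ , Cγ≡) (δ , 0<δ , Bδ≡) = go₃ (cx γ 0<γ) (cy δ 0<δ)
          where
          go₃ : ∃[ N ] (∀ i j → N ℕ.≤ i → N ℕ.≤ j → ∣ x i ℚ.- x j ∣ < γ) →
                ∃[ N ] (∀ i j → N ℕ.≤ i → N ℕ.≤ j → ∣ y i ℚ.- y j ∣ < δ) → Claim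
          go₃ (M₂ , hx) (N₂ , hy) = (M₁ ℕ.⊔ N₁) ℕ.⊔ (M₂ ℕ.⊔ N₂) , λ i j p q →
            *-difference-< (x i) (y i) (x j) (y j) {B} {C} {γ} {δ} 0<B 0<C
              (x≤B i (ℕ.m⊔n≤o⇒m≤o M₁ N₁ (lower p))) (y≤C j (ℕ.m⊔n≤o⇒n≤o M₁ N₁ (lower q)))
              (hy i j (ℕ.m⊔n≤o⇒n≤o M₂ N₂ (upper p)) (ℕ.m⊔n≤o⇒n≤o M₂ N₂ (upper q)))
              (hx i j (ℕ.m⊔n≤o⇒m≤o M₂ N₂ (upper p)) (ℕ.m⊔n≤o⇒m≤o M₂ N₂ (upper q)))
              Bδ≡ Cγ≡
            where
            lower : ∀ {k} → (M₁ ℕ.⊔ N₁) ℕ.⊔ (M₂ ℕ.⊔ N₂) ℕ.≤ k → M₁ ℕ.⊔ N₁ ℕ.≤ k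
            lower = ℕ.m⊔n≤o⇒m≤o (M₁ ℕ.⊔ N₁) (M₂ ℕ.⊔ N₂)
            upper : ∀ {k} → (M₁ ℕ.⊔ N₁) ℕ.⊔ (M₂ ℕ.⊔ N₂) ℕ.≤ k → M₂ ℕ.⊔ N₂ ℕ.≤ k
            upper = ℕ.m⊔n≤o⇒n≤o (M₁ ℕ.⊔ N₁) (M₂ ℕ.⊔ N₂)

infix  8 -ℝ_
infixl 7 _*ℝ_
infixl 6 _+ℝ_ _-ℝ_

_+ℝ_ : ℝ → ℝ → ℝ
x +ℝ y = mkℝ (λ i → seq x i ℚ.+ seq y i) (+-cauchy {seq x} {seq y} (cauchy x) (cauchy y))

_*ℝ_ : ℝ → ℝ → ℝ
x *ℝ y = mkℝ (λ i → seq x i ℚ.* seq y i) (*-cauchy {seq x} {seq y} (cauchy x) (cauchy y))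

-ℝ_ : ℝ → ℝ
-ℝ x = mkℝ (λ i → ℚ.- seq x i) (neg-cauchy {seq x} (cauchy x))

_-ℝ_ : ℝ → ℝ → ℝ
x -ℝ y = x +ℝ (-ℝ y)

ℝ-rawRing : RawRing 0ℓ 0ℓ
ℝ-rawRing = record
  { Carrier = ℝ
  ; _≈_     = _≈ℝ_
  ; _+_     = _+ℝ_
  ; _*_     = _*ℝ_
  ; -_      = -ℝ_
  ; 0#      = fromℚ 0ℚ
  ; 1#      = fromℚ 1ℚ
  }

module ℝ-ops = Algebra.Definitions.RawSemiring (RawRing.rawSemiring ℝ-rawRing)

-- r is the p-th root of a (p ≥ 1), taken to be nonnegative.
record IsRoot (p : ℕ) (a r : ℝ) : Set where
  field
    nonneg : fromℕ 0 ≤ℝ r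
    power  : r ℝ-ops.^ p ≈ℝ a

Matrix : Set → ℕ → Set
Matrix A n = Fin n → Fin n → A

module Determinant (R : RawRing 0ℓ 0ℓ) where
  open RawRing R
  open Algebra.Definitions.RawSemiring rawSemiring using (sum; _^_)

  -- Laplace expansion along the first row.
  det : ∀ {n} → Matrix Carrier n → Carrier
  det {zero}  M = 1#
  det {suc n} M = sum λ j →
    (- 1#) ^ toℕ j * (M zero j * det (λ i k → M (suc i) (punchIn j k)))

open Determinant ℝ-rawRing public using (det)

charMatrix : ∀ {n} → Matrix ℤ n → ℝ → Matrix ℝ n
charMatrix M x i j = (if does (i Fin.≟ j) then x else fromℕ 0) -ℝ fromℤ (M i j)

-- μ lists the eigenvalues of M with multiplicity, in decreasing order.
-- Agreement of det (x I − M) and ∏ (x − μ i) at every real x is equality of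
-- polynomials, since ℝ is infinite.
record IsSpectrum {n} (M : Matrix ℤ n) (μ : Vector ℝ n) : Set where
  field
    decreasing : ∀ i j → i Fin.≤ j → μ j ≤ℝ μ i
    charpoly   : ∀ x → det (charMatrix M x) ≈ℝ ℝ-ops.product (λ i → x -ℝ μ i)

record SimpleGraph (n : ℕ) : Set₁ where
  field
    Adj    : Rel (Fin n) 0ℓ
    adj?   : Decidable Adj
    symm   : Symmetric Adj
    irrefl : ∀ {i} → ¬ Adj i i

open Algebra.Definitions.RawMonoid ℕ.+-0-rawMonoid using (sum)

module _ {n : ℕ} (G : SimpleGraph n) where
  open SimpleGraph G

  adjacency : Matrix ℕ n
  adjacency i j = if does (adj? i j) then 1 else 0

  degree : Fin n → ℕ
  degree i = sum (adjacency i)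

  -- Each edge is counted once, at its endpoints i < j.
  edgeCount : ℕ
  edgeCount = sum λ i → sum λ j → if does (i Fin.<? j) ∧ does (adj? i j) then 1 else 0

  degreeMatrix : Matrix ℕ n
  degreeMatrix i j = if does (i Fin.≟ j) then degree i else 0

  laplacian : Matrix ℤ n
  laplacian i j = + degreeMatrix i j ℤ.- + adjacency i j

S : ∀ {n} (k : ℕ) → .(k ℕ.≤ n) → Vector ℝ n → ℝ
S k k≤n μ = ℝ-ops.sum λ (i : Fin k) → μ (inject≤ i k≤n)

{-# OPTIONS --safe #-}
module Submission where

-- The cube root bound gives 4mn ≤ k³ ≤ k²n, so 4m ≤ k² and m ≤ (k+1 choose 2); it remains to show
-- S_k ≤ 2m. Evaluating the characteristic polynomial at -y yields matrices yI + L with nonpositive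
-- off-diagonal entries and row sums y. Gaussian elimination preserves this shape and does not
-- increase the diagonal, so yⁿ ≤ det (yI + L) ≤ ∏ (y + dᵢ) for y > 0. The lower bound excludes
-- negative eigenvalues. For large y the upper bound, compared with ∏ (y + μᵢ) ≥ yⁿ + yⁿ⁻¹ ∑ μᵢ,
-- gives ∑ μᵢ ≤ ∑ dᵢ = 2m. All estimates are made on the rational approximations.

open import Algebra.Bundles using (CommutativeRing)
open import Algebra.Bundles.Raw using (RawRing)
open import Data.Bool.Base using (true; false; if_then_else_; _∧_)
open import Data.Bool.Properties using (∧-zeroʳ)
open import Data.Fin.Base as Fin using (Fin; zero; suc; toℕ; punchIn; lift; inject≤)
open import Data.Fin.Properties as Fin using (suc-injective)
open import Data.Integer.Base as ℤ using (ℤ; +_; -[1+_])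
import Data.Integer.Properties as ℤ
open import Data.Nat.Base as ℕ using (ℕ; zero; suc; NonZero; _+_; _*_; _∸_; _^_; _≤_)
open import Data.Nat.Combinatorics using (_C_; nCk+nC[k+1]≡[n+1]C[k+1]; nC1≡n)
open import Data.Nat.Coprimality as Coprimality using (1-coprimeTo)
import Data.Nat.Properties as ℕ
import Data.Nat.Solver as ℕ-Solver
open import Data.Product.Base using (_×_; _,_; ∃-syntax; proj₁; proj₂)
open import Data.Rational.Base as ℚ using (ℚ; 0ℚ; 1ℚ; ½; mkℚ; ∣_∣; _/_)
import Data.Rational.Properties as ℚ
open import Data.Rational.Solver using (module +-*-Solver)
open import Data.Sum.Base using (inj₁; inj₂)
open import Data.Vec.Functional using (Vector; _∷_)
open import Function.Base using (_∘_)
open import Function.Bundles using (mk⇔)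
open import Relation.Binary.Definitions using (tri<; tri≈; tri>)
open import Relation.Binary.PropositionalEquality
  using (_≡_; _≢_; _≗_; refl; sym; trans; cong; cong₂; subst; subst₂; module ≡-Reasoning)
open import Relation.Nullary using (does)
open import Relation.Nullary.Decidable using (dec-true; dec-false; does-⇔)
import Algebra.Definitions.RawSemiring
import Algebra.Properties.CommutativeMonoid.Sum ℕ.+-0-commutativeMonoid as ℕSum
import Algebra.Properties.Semiring.Sum (CommutativeRing.semiring ℚ.+-*-commutativeRing) as Sum
open import Defs

-- The eigenvalues are given only as roots of the characteristic polynomial, so their sum has to be
-- read off that polynomial. Extracting a coefficient exactly would mean expanding the determinant;
-- as only an upper bound is wanted, an inequality of Hadamard type at a single large argument
-- suffices. Nonnegativity of the spectrum serves twice: the first k eigenvalues can be completed to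
-- the full sum, and the lower-degree terms of the product can be discarded. The determinant is
-- defined by expansion along the first row, so elimination has to be justified from that expansion
-- alone. The core is that a twofold expansion is alternating in its two rows. Equality of real
-- numbers is equality up to an eventual error. Approximate eigenvalues may therefore be slightly
-- negative, and the product identity holds only within a tolerance. Hence the tolerance is fixed
-- before the approximations are inspected, and the eigenvalues are raised by a small η before they
-- are treated as nonnegative.

open Algebra.Definitions.RawSemiring (RawRing.rawSemiring ℚ.+-*-rawRing)
  using (sum; product) renaming (_^_ to _^ℚ_)

-- Determinants over ℚ

-- Opaque, so that unification can read the summand off a sum.
opaque
  ∑ : ∀ {n} → Vector ℚ n → ℚ
  ∑ = sum

  ∑-suc : ∀ {n} (f : Vector ℚ (suc n)) → ∑ f ≡ f zero ℚ.+ ∑ (f ∘ suc)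
  ∑-suc f = refl

  ∑-zero : (f : Vector ℚ 0) → ∑ f ≡ 0ℚ
  ∑-zero f = refl

  ∑-cong : ∀ {n} {f g : Vector ℚ n} → f ≗ g → ∑ f ≡ ∑ g
  ∑-cong = Sum.sum-cong-≗

  ∑-+ : ∀ {n} (f g : Vector ℚ n) → ∑ (λ i → f i ℚ.+ g i) ≡ ∑ f ℚ.+ ∑ g
  ∑-+ = Sum.∑-distrib-+

  ∑-*ˡ : ∀ {n} x (f : Vector ℚ n) → x ℚ.* ∑ f ≡ ∑ (λ i → x ℚ.* f i)
  ∑-*ˡ = Sum.*-distribˡ-sum

sign : ∀ {n} → Fin n → ℚ
sign j = (ℚ.- 1ℚ) ^ℚ toℕ j

minor : ∀ {n} → Matrix ℚ (suc n) → Fin (suc n) → Matrix ℚ n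
minor A j i k = A (suc i) (punchIn j k)

opaque
  unfolding ∑

  detℚ : ∀ {n} → Matrix ℚ n → ℚ
  detℚ = Determinant.det ℚ.+-*-rawRing

  det-suc : ∀ {n} (A : Matrix ℚ (suc n)) →
    detℚ A ≡ ∑ λ j → sign j ℚ.* (A zero j ℚ.* detℚ (minor A j))
  det-suc A = refl

  det-zero : (A : Matrix ℚ 0) → detℚ A ≡ 1ℚ
  det-zero A = refl

det-cong : ∀ {n} {A B : Matrix ℚ n} → (∀ i j → A i j ≡ B i j) → detℚ A ≡ detℚ B
det-cong {zero}  {A} {B} A≗B = trans (det-zero A) (sym (det-zero B))
det-cong {suc n} {A} {B} A≗B = begin
  detℚ A                                               ≡⟨ det-suc A ⟩
  ∑ (λ j → sign j ℚ.* (A zero j ℚ.* detℚ (minor A j)))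
    ≡⟨ ∑-cong (λ j → cong₂ (λ a d → sign j ℚ.* (a ℚ.* d)) (A≗B zero j)
         (det-cong λ i k → A≗B (suc i) (punchIn j k))) ⟩
  ∑ (λ j → sign j ℚ.* (B zero j ℚ.* detℚ (minor B j))) ≡⟨ sym (det-suc B) ⟩
  detℚ B                                               ∎
  where open ≡-Reasoning

∑-one : (f : Vector ℚ 1) → ∑ f ≡ f zero
∑-one f = trans (∑-suc f) (trans (cong (f zero ℚ.+_) (∑-zero _)) (ℚ.+-identityʳ (f zero)))

det-one : (A : Matrix ℚ 1) → detℚ A ≡ A zero zero
det-one A = begin
  detℚ A                                          ≡⟨ trans (det-suc A) (∑-one _) ⟩
  1ℚ ℚ.* (A zero zero ℚ.* detℚ (minor A zero))    ≡⟨ ℚ.*-identityˡ _ ⟩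
  A zero zero ℚ.* detℚ (minor A zero)             ≡⟨ cong (A zero zero ℚ.*_) (det-zero _) ⟩
  A zero zero ℚ.* 1ℚ                              ≡⟨ ℚ.*-identityʳ _ ⟩
  A zero zero                                     ∎
  where open ≡-Reasoning

-- Column selections that agree pointwise, such as different composites of `punchIn`, need not be
-- equal as functions, so a function of the selected columns has to respect `≗` explicitly.
Extensional : ∀ {m n} → ((Fin m → Fin n) → ℚ) → Set
Extensional D = ∀ {e e′} → e ≗ e′ → D e ≡ D e′

-- A Laplace expansion along two rows: `f` takes column `j`, `g` takes one of the remaining columns,
-- and `D` stands for the determinant of what is left, as a function of the surviving columns.
pairSum : ∀ {n} → ((Fin n → Fin (suc (suc n))) → ℚ) → (f g : Vector ℚ (suc (suc n))) → ℚ
pairSum D f g = ∑ λ j → ∑ λ l →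
  (sign j ℚ.* f j) ℚ.* ((sign l ℚ.* g (punchIn j l)) ℚ.* D (λ k → punchIn j (punchIn l k)))

module _ {n} (D : (Fin n → Fin (suc (suc n))) → ℚ) (f g : Vector ℚ (suc (suc n))) where

  firstSum : ℚ
  firstSum = ∑ λ l → f zero ℚ.* ((sign l ℚ.* g (suc l)) ℚ.* D (λ k → suc (punchIn l k)))

  restSum : ℚ
  restSum = ∑ λ j → ∑ λ l → (sign j ℚ.* f (suc j)) ℚ.*
    ((sign l ℚ.* g (suc (punchIn j l))) ℚ.* D (λ k → punchIn (suc j) (punchIn (suc l) k)))

-- Either `f` takes column 0, or `g` does, or neither. In the second case the index of `f` is
-- shifted by one, which produces the minus sign; in the third both indices are shifted and the two
-- signs cancel.
pairSum-split : ∀ {n} (D : (Fin n → Fin (suc (suc n))) → ℚ) → Extensional D → ∀ f g →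
  pairSum D f g ≡ (firstSum D f g ℚ.- firstSum D g f) ℚ.+ restSum D f g
pairSum-split {n} D ext f g = begin
  pairSum D f g
    ≡⟨ ∑-suc (λ j → ∑ λ l → (sign j ℚ.* f j) ℚ.* ((sign l ℚ.* g (punchIn j l)) ℚ.* D (λ k → punchIn j (punchIn l k)))) ⟩
  ∑ (λ l → (1ℚ ℚ.* f zero) ℚ.* gD l) ℚ.+ ∑ (λ j → ∑ (cell j))
    ≡⟨ cong₂ ℚ._+_ (∑-cong λ l → cong (ℚ._* gD l) (ℚ.*-identityˡ (f zero))) (∑-cong row) ⟩
  firstSum D f g ℚ.+ ∑ (λ j → (ℚ.- 1ℚ) ℚ.* swapped j ℚ.+ rest j)
    ≡⟨ cong (firstSum D f g ℚ.+_) (∑-+ _ rest) ⟩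
  firstSum D f g ℚ.+ (∑ (λ j → (ℚ.- 1ℚ) ℚ.* swapped j) ℚ.+ restSum D f g)
    ≡⟨ cong (λ x → firstSum D f g ℚ.+ (x ℚ.+ restSum D f g)) (sym (∑-*ˡ (ℚ.- 1ℚ) swapped)) ⟩
  firstSum D f g ℚ.+ ((ℚ.- 1ℚ) ℚ.* firstSum D g f ℚ.+ restSum D f g)
    ≡⟨ solve 3 (λ a b c → a :+ (con (ℚ.- 1ℚ) :* b :+ c) := (a :- b) :+ c) refl
         (firstSum D f g) (firstSum D g f) (restSum D f g) ⟩
  (firstSum D f g ℚ.- firstSum D g f) ℚ.+ restSum D f g ∎
  where
  open ≡-Reasoning
  open +-*-Solver
  gD : Fin (suc n) → ℚ
  gD l = (sign l ℚ.* g (suc l)) ℚ.* D (λ k → suc (punchIn l k))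
  swapped rest : Fin (suc n) → ℚ
  swapped j = g zero ℚ.* ((sign j ℚ.* f (suc j)) ℚ.* D (λ k → suc (punchIn j k)))
  rest j = ∑ λ l → (sign j ℚ.* f (suc j)) ℚ.*
    ((sign l ℚ.* g (suc (punchIn j l))) ℚ.* D (λ k → punchIn (suc j) (punchIn (suc l) k)))
  cell : Fin (suc n) → Fin (suc n) → ℚ
  cell j l = (sign (suc j) ℚ.* f (suc j)) ℚ.*
    ((sign l ℚ.* g (punchIn (suc j) l)) ℚ.* D (λ k → punchIn (suc j) (punchIn l k)))
  row : ∀ j → ∑ (cell j) ≡ (ℚ.- 1ℚ) ℚ.* swapped j ℚ.+ rest j
  row j = trans (∑-suc (cell j)) (cong₂ ℚ._+_
    (trans
      (cong (λ d → (sign (suc j) ℚ.* f (suc j)) ℚ.* ((1ℚ ℚ.* g zero) ℚ.* d)) (ext λ _ → refl))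
      (solve 4 (λ s x y d → (con (ℚ.- 1ℚ) :* s :* x) :* ((con 1ℚ :* y) :* d) :=
                 con (ℚ.- 1ℚ) :* (y :* ((s :* x) :* d))) refl
        (sign j) (f (suc j)) (g zero) (D (λ k → suc (punchIn j k)))))
    (∑-cong λ l →
      solve 5 (λ s t x y d → (con (ℚ.- 1ℚ) :* s :* x) :* ((con (ℚ.- 1ℚ) :* t :* y) :* d) :=
                 (s :* x) :* ((t :* y) :* d)) refl
        (sign j) (sign l) (f (suc j)) (g (suc (punchIn j l)))
        (D (λ k → punchIn (suc j) (punchIn (suc l) k)))))

-- Removing columns j < l or l < j leaves the same minor, with opposite signs.
pairSum-antisym : ∀ {n} (D : (Fin n → Fin (suc (suc n))) → ℚ) → Extensional D → ∀ f g →
  pairSum D f g ≡ ℚ.- pairSum D g f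
pairSum-antisym {n} D ext f g = begin
  pairSum D f g
    ≡⟨ pairSum-split D ext f g ⟩
  (firstSum D f g ℚ.- firstSum D g f) ℚ.+ restSum D f g
    ≡⟨ cong ((firstSum D f g ℚ.- firstSum D g f) ℚ.+_) (rest-antisym {f = f} {g} D ext) ⟩
  (firstSum D f g ℚ.- firstSum D g f) ℚ.+ (ℚ.- restSum D g f)
    ≡⟨ solve 3 (λ a b c → (a :- b) :+ (:- c) := :- ((b :- a) :+ c)) refl
         (firstSum D f g) (firstSum D g f) (restSum D g f) ⟩
  ℚ.- ((firstSum D g f ℚ.- firstSum D f g) ℚ.+ restSum D g f)
    ≡⟨ cong ℚ.-_ (sym (pairSum-split D ext g f)) ⟩
  ℚ.- pairSum D g f ∎
  where
  open ≡-Reasoning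
  open +-*-Solver
  rest-antisym : ∀ {n} {f g : Vector ℚ (suc (suc n))} (D : (Fin n → Fin (suc (suc n))) → ℚ) → Extensional D →
    restSum D f g ≡ ℚ.- restSum D g f
  -- With only two columns, one of the two rows has to take column 0, so the inner sums are empty.
  rest-antisym {zero} {f} {g} D ext = trans (empty f g) (cong ℚ.-_ (sym (empty g f)))
    where
    empty : ∀ f g → restSum D f g ≡ 0ℚ
    empty f g = trans (∑-suc _) (cong₂ ℚ._+_ (∑-zero _) (∑-zero _))
  rest-antisym {suc n} {f} {g} D ext = begin
    restSum D f g
      ≡⟨ tails f g ⟩
    pairSum (D ∘ lift 1) (f ∘ suc) (g ∘ suc)
      ≡⟨ pairSum-antisym (D ∘ lift 1) (λ {e} {e′} → ext′ {e} {e′}) (f ∘ suc) (g ∘ suc) ⟩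
    ℚ.- pairSum (D ∘ lift 1) (g ∘ suc) (f ∘ suc)
      ≡⟨ cong ℚ.-_ (sym (tails g f)) ⟩
    ℚ.- restSum D g f ∎
    where
    ext′ : Extensional (D ∘ lift 1)
    ext′ e≗e′ = ext λ { zero → refl ; (suc k) → cong suc (e≗e′ k) }
    -- As neither row takes column 0, it survives as the first selected column. `lift 1` puts it
    -- there, which leaves a twofold sum with one column fewer.
    tails : ∀ f g → restSum D f g ≡ pairSum (D ∘ lift 1) (f ∘ suc) (g ∘ suc)
    tails f g = ∑-cong λ j → ∑-cong λ l →
      cong (λ d → (sign j ℚ.* f (suc j)) ℚ.* ((sign l ℚ.* g (suc (punchIn j l))) ℚ.* d))
        (ext λ { zero → refl ; (suc k) → refl })

x≡-x⇒x≡0 : ∀ {x} → x ≡ ℚ.- x → x ≡ 0ℚ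
x≡-x⇒x≡0 {x} x≡-x = begin
  x                     ≡⟨ solve 1 (λ x → x := con ℚ.½ :* (x :+ x)) refl x ⟩
  ℚ.½ ℚ.* (x ℚ.+ x)     ≡⟨ cong (λ y → ℚ.½ ℚ.* (x ℚ.+ y)) x≡-x ⟩
  ℚ.½ ℚ.* (x ℚ.- x)     ≡⟨ solve 1 (λ x → con ℚ.½ :* (x :- x) := con 0ℚ) refl x ⟩
  0ℚ                    ∎
  where
  open ≡-Reasoning
  open +-*-Solver

-- Up to the sign `sign j` of moving `u` from the front back to position `j`, the determinant of
-- this matrix is that of `W` with column `j` replaced by `u`.
bordered : ∀ {n} → Matrix ℚ (suc n) → Vector ℚ (suc n) → Fin (suc n) → Matrix ℚ (suc n)
bordered W u j i = u i ∷ λ k → W i (punchIn j k)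

rankOne : ∀ {n} → Matrix ℚ n → Vector ℚ n → Vector ℚ n → Matrix ℚ n
rankOne W u b i j = W i j ℚ.+ b j ℚ.* u i

-- The matrix determinant lemma, with the adjugate term written out by Cramer's rule. Only terms of
-- degree at most one in `b` survive, since two columns proportional to `u` cancel. The induction
-- expands the first row and multiplies out the update of the row with the update of the minor.
det-rankOne : ∀ {n} (W : Matrix ℚ (suc n)) (u b : Vector ℚ (suc n)) →
  detℚ (rankOne W u b) ≡ detℚ W ℚ.+ ∑ (λ j → sign j ℚ.* b j ℚ.* detℚ (bordered W u j))
det-rankOne {zero} W u b = begin
  detℚ (rankOne W u b)                  ≡⟨ det-one (rankOne W u b) ⟩
  W zero zero ℚ.+ b zero ℚ.* u zero
    ≡⟨ cong₂ (λ x y → x ℚ.+ y ℚ.* u zero) (sym (det-one W)) (sym (ℚ.*-identityˡ (b zero))) ⟩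
  detℚ W ℚ.+ 1ℚ ℚ.* b zero ℚ.* u zero
    ≡⟨ cong (λ x → detℚ W ℚ.+ 1ℚ ℚ.* b zero ℚ.* x) (sym (det-one (bordered W u zero))) ⟩
  detℚ W ℚ.+ 1ℚ ℚ.* b zero ℚ.* detℚ (bordered W u zero)
    ≡⟨ cong (detℚ W ℚ.+_) (sym (∑-one _)) ⟩
  detℚ W ℚ.+ ∑ (λ j → sign j ℚ.* b j ℚ.* detℚ (bordered W u j)) ∎
  where open ≡-Reasoning
det-rankOne {suc n} W u b = begin
  detℚ (rankOne W u b)
    ≡⟨ trans (det-suc (rankOne W u b)) (∑-cong λ j →
         cong (λ d → sign j ℚ.* ((w j ℚ.+ b j ℚ.* u₀) ℚ.* d)) (det-rankOne (W⁻ j) u⁺ (b⁻ j))) ⟩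
  ∑ (λ j → sign j ℚ.* ((w j ℚ.+ b j ℚ.* u₀) ℚ.* (M j ℚ.+ inner b j)))
    ≡⟨ ∑-cong (λ j → solve 6 (λ s w b u m i → s :* ((w :+ b :* u) :* (m :+ i)) :=
         s :* (w :* m) :+ (s :* b :* (u :* m) :+ ((s :* w) :* i :+ u :* ((s :* b) :* i)))) refl
         (sign j) (w j) (b j) u₀ (M j) (inner b j)) ⟩
  ∑ (λ j → laplace j ℚ.+ (pivot j ℚ.+ ((sign j ℚ.* w j) ℚ.* inner b j ℚ.+ u₀ ℚ.* ((sign j ℚ.* b j) ℚ.* inner b j))))
    ≡⟨ trans (∑-+ laplace _) (cong₂ ℚ._+_ (sym (det-suc W))
        (trans (∑-+ pivot _) (cong (∑ pivot ℚ.+_)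
          (trans (∑-+ _ _)
            (cong₂ ℚ._+_ (pairs w b) (trans (sym (∑-*ˡ u₀ _)) (cong (u₀ ℚ.*_) (pairs b b)))))))) ⟩
  detℚ W ℚ.+ (∑ pivot ℚ.+ (pairSum D w b ℚ.+ u₀ ℚ.* pairSum D b b))
    -- The part quadratic in `b` is alternating with equal arguments, so it vanishes. The mixed part
    -- is reversed, so that the outer sum runs over the column of `b`, as it does in the expansion
    -- of the bordered determinants.
    ≡⟨ cong₂ (λ p q → detℚ W ℚ.+ (∑ pivot ℚ.+ (p ℚ.+ u₀ ℚ.* q)))
         (pairSum-antisym D ext w b) (x≡-x⇒x≡0 (pairSum-antisym D ext b b)) ⟩
  detℚ W ℚ.+ (∑ pivot ℚ.+ (ℚ.- pairSum D b w ℚ.+ u₀ ℚ.* 0ℚ))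
    ≡⟨ cong (λ x → detℚ W ℚ.+ (∑ pivot ℚ.+ x))
         (solve 2 (λ p u → :- p :+ u :* con 0ℚ := con (ℚ.- 1ℚ) :* p) refl (pairSum D b w) u₀) ⟩
  detℚ W ℚ.+ (∑ pivot ℚ.+ (ℚ.- 1ℚ) ℚ.* pairSum D b w)
    ≡⟨ cong (λ x → detℚ W ℚ.+ (∑ pivot ℚ.+ x))
         (trans (cong ((ℚ.- 1ℚ) ℚ.*_) (sym (pairs b w))) (∑-*ˡ (ℚ.- 1ℚ) (λ j → (sign j ℚ.* b j) ℚ.* inner w j))) ⟩
  detℚ W ℚ.+ (∑ pivot ℚ.+ ∑ (λ j → (ℚ.- 1ℚ) ℚ.* ((sign j ℚ.* b j) ℚ.* inner w j)))
    ≡⟨ cong (detℚ W ℚ.+_) (sym (trans (∑-cong expand) (∑-+ pivot _))) ⟩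
  detℚ W ℚ.+ ∑ (λ j → sign j ℚ.* b j ℚ.* detℚ (bordered W u j)) ∎
  where
  open ≡-Reasoning
  open +-*-Solver
  w : Vector ℚ (suc (suc n))
  w = W zero
  u₀ : ℚ
  u₀ = u zero
  u⁺ : Vector ℚ (suc n)
  u⁺ = u ∘ suc
  W⁻ : Fin (suc (suc n)) → Matrix ℚ (suc n)
  W⁻ j i k = W (suc i) (punchIn j k)
  b⁻ : Fin (suc (suc n)) → Vector ℚ (suc n)
  b⁻ j k = b (punchIn j k)
  M : Fin (suc (suc n)) → ℚ
  M j = detℚ (W⁻ j)
  D : (Fin n → Fin (suc (suc n))) → ℚ
  D e = detℚ λ i → u⁺ i ∷ λ k → W (suc i) (e k)
  ext : Extensional D
  ext e≗e′ = det-cong λ { i zero → refl ; i (suc k) → cong (W (suc i)) (e≗e′ k) }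
  inner : Vector ℚ (suc (suc n)) → Fin (suc (suc n)) → ℚ
  inner c j = ∑ λ l → sign l ℚ.* c (punchIn j l) ℚ.* detℚ (bordered (W⁻ j) u⁺ l)
  laplace pivot : Fin (suc (suc n)) → ℚ
  laplace j = sign j ℚ.* (w j ℚ.* M j)
  pivot j = sign j ℚ.* b j ℚ.* (u₀ ℚ.* M j)
  pairs : ∀ c d → ∑ (λ j → (sign j ℚ.* c j) ℚ.* inner d j) ≡ pairSum D c d
  pairs c d = ∑-cong λ j → ∑-*ˡ (sign j ℚ.* c j) _
  -- In the first row of `bordered W u j` the entry `u₀` gives the pivot term; the entries of `w`
  -- stand one place further right, whence the factor `- 1`.
  expand : ∀ j → sign j ℚ.* b j ℚ.* detℚ (bordered W u j) ≡
                 pivot j ℚ.+ (ℚ.- 1ℚ) ℚ.* ((sign j ℚ.* b j) ℚ.* inner w j)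
  expand j = trans
    (cong (sign j ℚ.* b j ℚ.*_)
      (trans (trans (det-suc (bordered W u j)) (∑-suc _)) (cong (1ℚ ℚ.* (u₀ ℚ.* M j) ℚ.+_)
      (trans (∑-cong λ l →
               trans (cong (λ d → sign (suc l) ℚ.* (w (punchIn j l) ℚ.* d))
                       (det-cong {B = bordered (W⁻ j) u⁺ l} λ { i zero → refl ; i (suc k) → refl }))
                     (solve 3 (λ s w d → con (ℚ.- 1ℚ) :* s :* (w :* d) := con (ℚ.- 1ℚ) :* (s :* w :* d)) refl
                       (sign l) (w (punchIn j l)) (detℚ (bordered (W⁻ j) u⁺ l))))
             (sym (∑-*ˡ (ℚ.- 1ℚ) _))))))
    (solve 5 (λ s b u m i → s :* b :* (con 1ℚ :* (u :* m) :+ con (ℚ.- 1ℚ) :* i) :=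
               s :* b :* (u :* m) :+ con (ℚ.- 1ℚ) :* ((s :* b) :* i)) refl
      (sign j) (b j) u₀ (M j) (inner w j))

opaque
  ∏ : ∀ {n} → Vector ℚ n → ℚ
  ∏ = product

  ∏-suc : ∀ {n} (f : Vector ℚ (suc n)) → ∏ f ≡ f zero ℚ.* ∏ (f ∘ suc)
  ∏-suc f = refl

  ∏-zero : (f : Vector ℚ 0) → ∏ f ≡ 1ℚ
  ∏-zero f = refl

-- When `c` is the inverse of the corner entry, this is its Schur complement, the result of one
-- elimination step, written as a rank-one update of the lower right block.
schur : ∀ {n} → Matrix ℚ (suc n) → ℚ → Matrix ℚ n
schur A c = rankOne (minor A zero) (λ i → A (suc i) zero) (λ j → ℚ.- (c ℚ.* A zero (suc j)))

-- Deleting column `suc j` below the first row leaves `bordered W u j`, with `u` the rest of column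
-- 0. So the first-row expansion of `A` is `det-rankOne` read backwards, once a factor `a * c` is
-- inserted.
det-schur : ∀ {n} (A : Matrix ℚ (suc n)) {c} → A zero zero ℚ.* c ≡ 1ℚ →
  detℚ A ≡ A zero zero ℚ.* detℚ (schur A c)
det-schur {zero} A {c} ac≡1 = begin
  detℚ A                            ≡⟨ det-one A ⟩
  A zero zero                       ≡⟨ sym (ℚ.*-identityʳ _) ⟩
  A zero zero ℚ.* 1ℚ                ≡⟨ cong (A zero zero ℚ.*_) (sym (det-zero (schur A c))) ⟩
  A zero zero ℚ.* detℚ (schur A c)  ∎
  where open ≡-Reasoning
det-schur {suc n} A {c} ac≡1 = begin
  detℚ A
    ≡⟨ trans (det-suc A) (∑-suc _) ⟩
  1ℚ ℚ.* (a ℚ.* detℚ W) ℚ.+ ∑ (λ j → sign (suc j) ℚ.* (A zero (suc j) ℚ.* detℚ (minor A (suc j))))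
    ≡⟨ cong₂ ℚ._+_ (ℚ.*-identityˡ (a ℚ.* detℚ W)) (∑-cong term) ⟩
  a ℚ.* detℚ W ℚ.+ ∑ (λ j → a ℚ.* (sign j ℚ.* b j ℚ.* detℚ (bordered W u j)))
    ≡⟨ cong (a ℚ.* detℚ W ℚ.+_) (sym (∑-*ˡ a _)) ⟩
  a ℚ.* detℚ W ℚ.+ a ℚ.* ∑ (λ j → sign j ℚ.* b j ℚ.* detℚ (bordered W u j))
    ≡⟨ sym (ℚ.*-distribˡ-+ a _ _) ⟩
  a ℚ.* (detℚ W ℚ.+ ∑ (λ j → sign j ℚ.* b j ℚ.* detℚ (bordered W u j)))
    ≡⟨ cong (a ℚ.*_) (sym (det-rankOne W u b)) ⟩
  a ℚ.* detℚ (schur A c) ∎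
  where
  open ≡-Reasoning
  open +-*-Solver
  a : ℚ
  a = A zero zero
  W : Matrix ℚ (suc n)
  W = minor A zero
  u b : Vector ℚ (suc n)
  u i = A (suc i) zero
  b j = ℚ.- (c ℚ.* A zero (suc j))
  term : ∀ j → sign (suc j) ℚ.* (A zero (suc j) ℚ.* detℚ (minor A (suc j))) ≡
               a ℚ.* (sign j ℚ.* b j ℚ.* detℚ (bordered W u j))
  term j = begin
    sign (suc j) ℚ.* (A zero (suc j) ℚ.* detℚ (minor A (suc j)))
      ≡⟨ cong (λ d → sign (suc j) ℚ.* (A zero (suc j) ℚ.* d))
           (det-cong {B = bordered W u j} λ { i zero → refl ; i (suc k) → refl }) ⟩
    sign (suc j) ℚ.* (A zero (suc j) ℚ.* d)
      ≡⟨ solve 3 (λ s x d → con (ℚ.- 1ℚ) :* s :* (x :* d) := con (ℚ.- 1ℚ) :* con 1ℚ :* (s :* x :* d)) refl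
           (sign j) (A zero (suc j)) d ⟩
    (ℚ.- 1ℚ) ℚ.* 1ℚ ℚ.* (sign j ℚ.* A zero (suc j) ℚ.* d)
      ≡⟨ cong (λ o → (ℚ.- 1ℚ) ℚ.* o ℚ.* (sign j ℚ.* A zero (suc j) ℚ.* d)) (sym ac≡1) ⟩
    (ℚ.- 1ℚ) ℚ.* (a ℚ.* c) ℚ.* (sign j ℚ.* A zero (suc j) ℚ.* d)
      ≡⟨ solve 5 (λ a c s x d → con (ℚ.- 1ℚ) :* (a :* c) :* (s :* x :* d) := a :* (s :* (:- (c :* x)) :* d)) refl
           a c (sign j) (A zero (suc j)) d ⟩
    a ℚ.* (sign j ℚ.* b j ℚ.* d) ∎
    where
    d : ℚ
    d = detℚ (bordered W u j)

-- Diagonally dominant matrices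

-- Many inequalities below are proved in this form: an explicit nonnegative gap, with the remaining
-- identity left to the ring solver.
≤-diff : ∀ {p q d} → 0ℚ ℚ.≤ d → p ℚ.+ d ≡ q → p ℚ.≤ q
≤-diff {p} 0≤d p+d≡q = subst₂ ℚ._≤_ (ℚ.+-identityʳ p) p+d≡q (ℚ.+-monoʳ-≤ p 0≤d)

0≤* : ∀ {p q} → 0ℚ ℚ.≤ p → 0ℚ ℚ.≤ q → 0ℚ ℚ.≤ p ℚ.* q
0≤* {p} {q} 0≤p 0≤q = ℚ.nonNegative⁻¹ (p ℚ.* q)
  {{ℚ.nonNeg*nonNeg⇒nonNeg p {{ℚ.nonNegative 0≤p}} q {{ℚ.nonNegative 0≤q}}}}

0<* : ∀ {p q} → 0ℚ ℚ.< p → 0ℚ ℚ.< q → 0ℚ ℚ.< p ℚ.* q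
0<* {p} {q} 0<p 0<q = ℚ.positive⁻¹ (p ℚ.* q)
  {{ℚ.pos*pos⇒pos p {{ℚ.positive 0<p}} q {{ℚ.positive 0<q}}}}

neg-≤0 : ∀ {p} → p ℚ.≤ 0ℚ → 0ℚ ℚ.≤ ℚ.- p
neg-≤0 = ℚ.neg-antimono-≤

*-mono-≤ : ∀ {p q r s} → 0ℚ ℚ.≤ p → 0ℚ ℚ.≤ r → p ℚ.≤ q → r ℚ.≤ s → p ℚ.* r ℚ.≤ q ℚ.* s
*-mono-≤ {p} {q} {r} {s} 0≤p 0≤r p≤q r≤s = ℚ.≤-trans
  (ℚ.*-monoʳ-≤-nonNeg r {{ℚ.nonNegative 0≤r}} p≤q)
  (ℚ.*-monoˡ-≤-nonNeg q {{ℚ.nonNegative (ℚ.≤-trans 0≤p p≤q)}} r≤s)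

0≤^ : ∀ {y} → 0ℚ ℚ.≤ y → ∀ n → 0ℚ ℚ.≤ y ^ℚ n
0≤^ 0≤y zero    = ℚ.nonNegative⁻¹ 1ℚ
0≤^ 0≤y (suc n) = 0≤* 0≤y (0≤^ 0≤y n)

0<^ : ∀ {y} → 0ℚ ℚ.< y → ∀ n → 0ℚ ℚ.< y ^ℚ n
0<^ 0<y zero    = ℚ.positive⁻¹ 1ℚ
0<^ 0<y (suc n) = 0<* 0<y (0<^ 0<y n)

∑-mono-≤ : ∀ {n} {f g : Vector ℚ n} → (∀ i → f i ℚ.≤ g i) → ∑ f ℚ.≤ ∑ g
∑-mono-≤ {zero}  {f} {g} f≤g = ℚ.≤-reflexive (trans (∑-zero f) (sym (∑-zero g)))
∑-mono-≤ {suc n} {f} {g} f≤g = subst₂ ℚ._≤_ (sym (∑-suc f)) (sym (∑-suc g))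
  (ℚ.+-mono-≤ (f≤g zero) (∑-mono-≤ (f≤g ∘ suc)))

∑-const-0 : ∀ n → ∑ {n} (λ _ → 0ℚ) ≡ 0ℚ
∑-const-0 zero    = ∑-zero _
∑-const-0 (suc n) = trans (∑-suc _) (trans (ℚ.+-identityˡ _) (∑-const-0 n))

∑-nonNeg : ∀ {n} {f : Vector ℚ n} → (∀ i → 0ℚ ℚ.≤ f i) → 0ℚ ℚ.≤ ∑ f
∑-nonNeg {n} {f} 0≤f = subst (ℚ._≤ ∑ f) (∑-const-0 n) (∑-mono-≤ 0≤f)

∑-nonPos : ∀ {n} {f : Vector ℚ n} → (∀ i → f i ℚ.≤ 0ℚ) → ∑ f ℚ.≤ 0ℚ
∑-nonPos {n} {f} f≤0 = subst (∑ f ℚ.≤_) (∑-const-0 n) (∑-mono-≤ f≤0)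

∏-nonNeg : ∀ {n} {f : Vector ℚ n} → (∀ i → 0ℚ ℚ.≤ f i) → 0ℚ ℚ.≤ ∏ f
∏-nonNeg {zero}  {f} 0≤f = subst (0ℚ ℚ.≤_) (sym (∏-zero f)) (ℚ.nonNegative⁻¹ 1ℚ)
∏-nonNeg {suc n} {f} 0≤f = subst (0ℚ ℚ.≤_) (sym (∏-suc f)) (0≤* (0≤f zero) (∏-nonNeg (0≤f ∘ suc)))

∏-mono-≤ : ∀ {n} {f g : Vector ℚ n} → (∀ i → 0ℚ ℚ.≤ f i) → (∀ i → f i ℚ.≤ g i) → ∏ f ℚ.≤ ∏ g
∏-mono-≤ {zero}  {f} {g} 0≤f f≤g = ℚ.≤-reflexive (trans (∏-zero f) (sym (∏-zero g)))
∏-mono-≤ {suc n} {f} {g} 0≤f f≤g = subst₂ ℚ._≤_ (sym (∏-suc f)) (sym (∏-suc g))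
  (*-mono-≤ (0≤f zero) (∏-nonNeg (0≤f ∘ suc)) (f≤g zero) (∏-mono-≤ (0≤f ∘ suc) (f≤g ∘ suc)))

reciprocal : ∀ {p} → 0ℚ ℚ.< p → ∃[ c ] (0ℚ ℚ.< c × p ℚ.* c ≡ 1ℚ)
reciprocal {p} 0<p = ℚ.1/ p , ℚ.positive⁻¹ (ℚ.1/ p) {{ℚ.1/pos⇒pos p}} , ℚ.*-inverseʳ p
  where
  instance
    p-pos : ℚ.Positive p
    p-pos = ℚ.positive 0<p
    p≢0 : ℚ.NonZero p
    p≢0 = ℚ.pos⇒nonZero p

-- For `y > 0` these are strictly diagonally dominant M-matrices. With the off-diagonal signs fixed,
-- dominance becomes a linear condition on signed row sums, which is easy to follow through
-- elimination.
record DominantZMatrix {n} (y : ℚ) (A : Matrix ℚ n) : Set where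
  field
    offDiagonal : ∀ i j → i ≢ j → A i j ℚ.≤ 0ℚ
    rowSum      : ∀ i → y ℚ.≤ ∑ (A i)

open DominantZMatrix

-- Elimination adds the nonnegative multiple `(- u i) * c` of row 0 to row `suc i` and makes its
-- first entry zero. The row sum thus grows by a nonnegative multiple of the sum of row 0, and
-- off-diagonal entries only decrease.
schur-dominant : ∀ {n y} {A : Matrix ℚ (suc n)} {c} → 0ℚ ℚ.≤ y → 0ℚ ℚ.≤ c → A zero zero ℚ.* c ≡ 1ℚ →
  DominantZMatrix y A → DominantZMatrix y (schur A c)
schur-dominant {n} {y} {A} {c} 0≤y 0≤c ac≡1 dom = record { offDiagonal = off ; rowSum = rows }
  where
  open +-*-Solver
  u R : Vector ℚ n
  u i = A (suc i) zero
  R i = ∑ (λ j → A (suc i) (suc j))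
  R₀ : ℚ
  R₀ = ∑ (λ j → A zero (suc j))
  0≤-u : ∀ i → 0ℚ ℚ.≤ ℚ.- u i
  0≤-u i = neg-≤0 (offDiagonal dom (suc i) zero λ ())
  off : ∀ i j → i ≢ j → schur A c i j ℚ.≤ 0ℚ
  off i j i≢j = ℚ.≤-trans
    (≤-diff (0≤* (0≤* 0≤c (neg-≤0 (offDiagonal dom zero (suc j) λ ()))) (0≤-u i))
      (solve 4 (λ a c x u → (a :+ (:- (c :* x)) :* u) :+ (c :* (:- x)) :* (:- u) := a) refl
        (A (suc i) (suc j)) c (A zero (suc j)) (u i)))
    (offDiagonal dom (suc i) (suc j) (i≢j ∘ suc-injective))
  rows : ∀ i → y ℚ.≤ ∑ (schur A c i)
  rows i = ℚ.≤-trans (subst (y ℚ.≤_) (∑-suc (A (suc i))) (rowSum dom (suc i)))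
    (≤-diff (0≤* (0≤-u i) (0≤* 0≤c (subst (0ℚ ℚ.≤_) (∑-suc (A zero)) (ℚ.≤-trans 0≤y (rowSum dom zero))))) eq)
    where
    open ≡-Reasoning
    eq : (u i ℚ.+ R i) ℚ.+ (ℚ.- u i) ℚ.* (c ℚ.* (A zero zero ℚ.+ R₀)) ≡ ∑ (schur A c i)
    eq = begin
      (u i ℚ.+ R i) ℚ.+ (ℚ.- u i) ℚ.* (c ℚ.* (A zero zero ℚ.+ R₀))
        ≡⟨ solve 5 (λ u r c a s → (u :+ r) :+ (:- u) :* (c :* (a :+ s)) :=
             (u :+ r) :+ (:- u) :* (a :* c :+ c :* s)) refl (u i) (R i) c (A zero zero) R₀ ⟩
      (u i ℚ.+ R i) ℚ.+ (ℚ.- u i) ℚ.* (A zero zero ℚ.* c ℚ.+ c ℚ.* R₀)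
        ≡⟨ cong (λ o → (u i ℚ.+ R i) ℚ.+ (ℚ.- u i) ℚ.* (o ℚ.+ c ℚ.* R₀)) ac≡1 ⟩
      (u i ℚ.+ R i) ℚ.+ (ℚ.- u i) ℚ.* (1ℚ ℚ.+ c ℚ.* R₀)
        ≡⟨ solve 4 (λ u r c s → (u :+ r) :+ (:- u) :* (con 1ℚ :+ c :* s) :=
             r :+ ((:- u) :* c) :* s) refl (u i) (R i) c R₀ ⟩
      R i ℚ.+ ((ℚ.- u i) ℚ.* c) ℚ.* R₀
        ≡⟨ cong (R i ℚ.+_) (trans (∑-*ˡ ((ℚ.- u i) ℚ.* c) _) (∑-cong λ j →
             solve 3 (λ u c x → ((:- u) :* c) :* x := (:- (c :* x)) :* u) refl (u i) c (A zero (suc j)))) ⟩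
      R i ℚ.+ ∑ (λ j → (ℚ.- (c ℚ.* A zero (suc j))) ℚ.* u i)
        ≡⟨ sym (∑-+ _ _) ⟩
      ∑ (schur A c i) ∎

diagonal-≥ : ∀ {n y} {A : Matrix ℚ n} → DominantZMatrix y A → ∀ i → y ℚ.≤ A i i
diagonal-≥ {n} {y} {A} dom i = ℚ.≤-trans (rowSum dom i)
  (single (A i) i (offDiagonal dom i))
  where
  single : ∀ {n} (f : Vector ℚ n) i → (∀ j → i ≢ j → f j ℚ.≤ 0ℚ) → ∑ f ℚ.≤ f i
  single f zero    f≤0 = subst₂ ℚ._≤_ (sym (∑-suc f)) (ℚ.+-identityʳ (f zero))
    (ℚ.+-monoʳ-≤ (f zero) (∑-nonPos λ j → f≤0 (suc j) λ ()))
  single f (suc i) f≤0 = subst₂ ℚ._≤_ (sym (∑-suc f)) (ℚ.+-identityˡ (f (suc i)))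
    (ℚ.+-mono-≤ (f≤0 zero λ ()) (single (f ∘ suc) i λ j i≢j → f≤0 (suc j) (i≢j ∘ suc-injective)))

-- The determinant is the product of the pivots, each of which lies between `y` and the original
-- diagonal entry. The upper half is Hadamard's inequality for this class of matrices.
det-bounds : ∀ {n y} {A : Matrix ℚ n} → 0ℚ ℚ.< y → DominantZMatrix y A →
  y ^ℚ n ℚ.≤ detℚ A × detℚ A ℚ.≤ ∏ (λ i → A i i)
det-bounds {zero}  {y} {A} 0<y dom =
  ℚ.≤-reflexive (sym (det-zero A)) , ℚ.≤-reflexive (trans (det-zero A) (sym (∏-zero _)))
det-bounds {suc n} {y} {A} 0<y dom with reciprocal (ℚ.<-≤-trans 0<y (diagonal-≥ dom zero))
... | c , 0<c , ac≡1 with det-bounds 0<y (schur-dominant (ℚ.<⇒≤ 0<y) (ℚ.<⇒≤ 0<c) ac≡1 dom)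
... | lower , upper =
    subst (y ^ℚ suc n ℚ.≤_) (sym (det-schur A ac≡1)) (*-mono-≤ 0≤y (0≤^ 0≤y n) y≤a lower)
  , subst₂ ℚ._≤_ (sym (det-schur A ac≡1)) (sym (∏-suc _))
      (*-mono-≤ (ℚ.≤-trans 0≤y y≤a) (ℚ.≤-trans (0≤^ 0≤y n) lower) ℚ.≤-refl
        (ℚ.≤-trans upper (∏-mono-≤ (λ i → ℚ.≤-trans 0≤y (diagonal-≥ dom′ i)) diag)))
  where
  open +-*-Solver
  0≤y : 0ℚ ℚ.≤ y
  0≤y = ℚ.<⇒≤ 0<y
  y≤a : y ℚ.≤ A zero zero
  y≤a = diagonal-≥ dom zero
  dom′ : DominantZMatrix y (schur A c)
  dom′ = schur-dominant 0≤y (ℚ.<⇒≤ 0<c) ac≡1 dom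
  diag : ∀ i → schur A c i i ℚ.≤ A (suc i) (suc i)
  diag i = ≤-diff
    (0≤* (0≤* (ℚ.<⇒≤ 0<c) (neg-≤0 (offDiagonal dom zero (suc i) λ ()))) (neg-≤0 (offDiagonal dom (suc i) zero λ ())))
    (solve 4 (λ a c x u → (a :+ (:- (c :* x)) :* u) :+ (c :* (:- x)) :* (:- u) := a) refl
      (A (suc i) (suc i)) c (A zero (suc i)) (A (suc i) zero))

-- From real to rational characteristic polynomials

∏-cong : ∀ {n} {f g : Vector ℚ n} → f ≗ g → ∏ f ≡ ∏ g
∏-cong {zero}  {f} {g} f≗g = trans (∏-zero f) (sym (∏-zero g))
∏-cong {suc n} {f} {g} f≗g =
  trans (∏-suc f) (trans (cong₂ ℚ._*_ (f≗g zero) (∏-cong (f≗g ∘ suc))) (sym (∏-suc g)))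

∏-annihilated : ∀ {n} {f : Vector ℚ n} i → f i ≡ 0ℚ → ∏ f ≡ 0ℚ
∏-annihilated {f = f} zero    f≡0 = trans (∏-suc f) (trans (cong (ℚ._* ∏ (f ∘ suc)) f≡0) (ℚ.*-zeroˡ (∏ (f ∘ suc))))
∏-annihilated {f = f} (suc i) f≡0 =
  trans (∏-suc f) (trans (cong (f zero ℚ.*_) (∏-annihilated i f≡0)) (ℚ.*-zeroʳ (f zero)))

∏-neg : ∀ {n} (f : Vector ℚ n) → ∏ (λ i → ℚ.- f i) ≡ (ℚ.- 1ℚ) ^ℚ n ℚ.* ∏ f
∏-neg {zero}  f = trans (∏-zero _) (sym (cong (1ℚ ℚ.*_) (∏-zero f)))
∏-neg {suc n} f = begin
  ∏ (λ i → ℚ.- f i)                                   ≡⟨ ∏-suc _ ⟩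
  (ℚ.- f zero) ℚ.* ∏ (λ i → ℚ.- f (suc i))
    ≡⟨ cong ((ℚ.- f zero) ℚ.*_) (∏-neg (f ∘ suc)) ⟩
  (ℚ.- f zero) ℚ.* ((ℚ.- 1ℚ) ^ℚ n ℚ.* ∏ (f ∘ suc))
    ≡⟨ solve 3 (λ x s p → (:- x) :* (s :* p) := con (ℚ.- 1ℚ) :* s :* (x :* p)) refl
         (f zero) ((ℚ.- 1ℚ) ^ℚ n) (∏ (f ∘ suc)) ⟩
  (ℚ.- 1ℚ) ^ℚ suc n ℚ.* (f zero ℚ.* ∏ (f ∘ suc))       ≡⟨ cong ((ℚ.- 1ℚ) ^ℚ suc n ℚ.*_) (sym (∏-suc f)) ⟩
  (ℚ.- 1ℚ) ^ℚ suc n ℚ.* ∏ f                            ∎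
  where
  open ≡-Reasoning
  open +-*-Solver

det-neg : ∀ {n} (A : Matrix ℚ n) → detℚ (λ i j → ℚ.- A i j) ≡ (ℚ.- 1ℚ) ^ℚ n ℚ.* detℚ A
det-neg {zero}  A = trans (det-zero _) (sym (cong (1ℚ ℚ.*_) (det-zero A)))
det-neg {suc n} A = begin
  detℚ (λ i j → ℚ.- A i j)
    ≡⟨ det-suc _ ⟩
  ∑ (λ j → sign j ℚ.* ((ℚ.- A zero j) ℚ.* detℚ (λ i k → ℚ.- minor A j i k)))
    ≡⟨ ∑-cong (λ j → trans
         (cong (λ d → sign j ℚ.* ((ℚ.- A zero j) ℚ.* d)) (det-neg (minor A j)))
         (solve 4 (λ s a t d → s :* ((:- a) :* (t :* d)) := con (ℚ.- 1ℚ) :* t :* (s :* (a :* d))) refl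
           (sign j) (A zero j) ((ℚ.- 1ℚ) ^ℚ n) (detℚ (minor A j)))) ⟩
  ∑ (λ j → (ℚ.- 1ℚ) ^ℚ suc n ℚ.* (sign j ℚ.* (A zero j ℚ.* detℚ (minor A j))))
    ≡⟨ sym (∑-*ˡ ((ℚ.- 1ℚ) ^ℚ suc n) _) ⟩
  (ℚ.- 1ℚ) ^ℚ suc n ℚ.* ∑ (λ j → sign j ℚ.* (A zero j ℚ.* detℚ (minor A j)))
    ≡⟨ cong ((ℚ.- 1ℚ) ^ℚ suc n ℚ.*_) (sym (det-suc A)) ⟩
  (ℚ.- 1ℚ) ^ℚ suc n ℚ.* detℚ A ∎
  where
  open ≡-Reasoning
  open +-*-Solver

∣[-1]^n*p∣≡∣p∣ : ∀ n p → ∣ (ℚ.- 1ℚ) ^ℚ n ℚ.* p ∣ ≡ ∣ p ∣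
∣[-1]^n*p∣≡∣p∣ n p = begin
  ∣ (ℚ.- 1ℚ) ^ℚ n ℚ.* p ∣      ≡⟨ ℚ.∣p*q∣≡∣p∣*∣q∣ ((ℚ.- 1ℚ) ^ℚ n) p ⟩
  ∣ (ℚ.- 1ℚ) ^ℚ n ∣ ℚ.* ∣ p ∣  ≡⟨ cong (ℚ._* ∣ p ∣) (unit n) ⟩
  1ℚ ℚ.* ∣ p ∣                ≡⟨ ℚ.*-identityˡ ∣ p ∣ ⟩
  ∣ p ∣                       ∎
  where
  open ≡-Reasoning
  unit : ∀ n → ∣ (ℚ.- 1ℚ) ^ℚ n ∣ ≡ 1ℚ
  unit zero    = refl
  unit (suc n) = trans (ℚ.∣p*q∣≡∣p∣*∣q∣ (ℚ.- 1ℚ) ((ℚ.- 1ℚ) ^ℚ n)) (cong (1ℚ ℚ.*_) (unit n))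

seq-^ : ∀ x n t → seq (x ℝ-ops.^ n) t ≡ seq x t ^ℚ n
seq-^ x zero    t = refl
seq-^ x (suc n) t = cong (seq x t ℚ.*_) (seq-^ x n t)

seq-sum : ∀ {n} (f : Vector ℝ n) t → seq (ℝ-ops.sum f) t ≡ ∑ (λ i → seq (f i) t)
seq-sum {zero}  f t = sym (∑-zero _)
seq-sum {suc n} f t = trans (cong (seq (f zero) t ℚ.+_) (seq-sum (f ∘ suc) t)) (sym (∑-suc _))

seq-product : ∀ {n} (f : Vector ℝ n) t → seq (ℝ-ops.product f) t ≡ ∏ (λ i → seq (f i) t)
seq-product {zero}  f t = sym (∏-zero _)
seq-product {suc n} f t = trans (cong (seq (f zero) t ℚ.*_) (seq-product (f ∘ suc) t)) (sym (∏-suc _))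

-- Real operations act term by term on sequences, so each term of a real determinant is a rational
-- determinant, to which the elimination above applies. No ring laws for `ℝ` have to be established.
seq-det : ∀ {n} (M : Matrix ℝ n) t → seq (det M) t ≡ detℚ (λ i j → seq (M i j) t)
seq-det {zero}  M t = sym (det-zero _)
seq-det {suc n} M t = begin
  seq (det M) t
    ≡⟨ seq-sum (λ j → (-ℝ fromℚ 1ℚ) ℝ-ops.^ toℕ j *ℝ (M zero j *ℝ det (minorℝ j))) t ⟩
  ∑ (λ j → seq ((-ℝ fromℚ 1ℚ) ℝ-ops.^ toℕ j) t ℚ.* (seq (M zero j) t ℚ.* seq (det (minorℝ j)) t))
    ≡⟨ ∑-cong (λ j → cong₂ (λ s d → s ℚ.* (seq (M zero j) t ℚ.* d))
         (seq-^ (-ℝ fromℚ 1ℚ) (toℕ j) t) (seq-det (minorℝ j) t)) ⟩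
  ∑ (λ j → sign j ℚ.* (seq (M zero j) t ℚ.* detℚ (λ i k → seq (minorℝ j i k) t)))
    ≡⟨ sym (det-suc _) ⟩
  detℚ (λ i j → seq (M i j) t) ∎
  where
  open ≡-Reasoning
  minorℝ : Fin (suc n) → Matrix ℝ n
  minorℝ j i k = M (suc i) (punchIn j k)

Eventually : (ℕ → Set) → Set
Eventually P = ∃[ N ] (∀ t → N ℕ.≤ t → P t)

_∩_ : ∀ {P Q} → Eventually P → Eventually Q → Eventually (λ t → P t × Q t)
(M , p) ∩ (N , q) = M ℕ.⊔ N , λ t le → p t (ℕ.m⊔n≤o⇒m≤o M N le) , q t (ℕ.m⊔n≤o⇒n≤o M N le)

eventually-∀ : ∀ {n} {P : Fin n → ℕ → Set} →
  (∀ i → Eventually (P i)) → Eventually (λ t → ∀ i → P i t)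
eventually-∀ {zero}  h = 0 , λ _ _ ()
eventually-∀ {suc n} h with h zero ∩ eventually-∀ (h ∘ suc)
... | N , p = N , λ { t le zero → proj₁ (p t le) ; t le (suc i) → proj₂ (p t le) i }

shifted : ∀ {n} → Matrix ℤ n → ℚ → Matrix ℚ n
shifted M y i j = (if does (i Fin.≟ j) then y else 0ℚ) ℚ.+ M i j ℚ./ 1

-- The characteristic polynomial at -w, up to the sign (-1)ⁿ.
charpoly-shifted : ∀ {n} {M : Matrix ℤ n} {μ} → IsSpectrum M μ → ∀ w {ε} → 0ℚ ℚ.< ε →
  Eventually λ t → ∣ detℚ (shifted M (seq w t)) ℚ.- ∏ (λ j → seq w t ℚ.+ seq (μ j) t) ∣ ℚ.< ε
charpoly-shifted {n} {M} {μ} spec w {ε} 0<ε with close (IsSpectrum.charpoly spec (-ℝ w)) ε 0<ε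
... | N , h = N , λ t le → subst (ℚ._< ε) (eq t) (h t le)
  where
  open ≡-Reasoning
  open +-*-Solver
  entry : ∀ t i j → seq (charMatrix M (-ℝ w) i j) t ≡ ℚ.- shifted M (seq w t) i j
  entry t i j with does (i Fin.≟ j)
  ... | true  = sym (ℚ.neg-distrib-+ (seq w t) (M i j ℚ./ 1))
  ... | false = sym (ℚ.neg-distrib-+ 0ℚ (M i j ℚ./ 1))
  eq : ∀ t → ∣ seq (det (charMatrix M (-ℝ w))) t ℚ.- seq (ℝ-ops.product (λ j → (-ℝ w) -ℝ μ j)) t ∣ ≡
             ∣ detℚ (shifted M (seq w t)) ℚ.- ∏ (λ j → seq w t ℚ.+ seq (μ j) t) ∣
  eq t = begin
    ∣ seq (det (charMatrix M (-ℝ w))) t ℚ.- seq (ℝ-ops.product (λ j → (-ℝ w) -ℝ μ j)) t ∣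
      ≡⟨ cong₂ (λ d p → ∣ d ℚ.- p ∣)
           (trans (seq-det (charMatrix M (-ℝ w)) t) (trans (det-cong (entry t)) (det-neg _)))
           (trans (seq-product (λ j → (-ℝ w) -ℝ μ j) t)
             (trans (∏-cong λ j → sym (ℚ.neg-distrib-+ (seq w t) (seq (μ j) t))) (∏-neg _))) ⟩
    ∣ (ℚ.- 1ℚ) ^ℚ n ℚ.* D ℚ.- (ℚ.- 1ℚ) ^ℚ n ℚ.* P ∣
      ≡⟨ cong ∣_∣ (solve 3 (λ s d p → s :* d :- s :* p := s :* (d :- p)) refl ((ℚ.- 1ℚ) ^ℚ n) D P) ⟩
    ∣ (ℚ.- 1ℚ) ^ℚ n ℚ.* (D ℚ.- P) ∣
      ≡⟨ ∣[-1]^n*p∣≡∣p∣ n (D ℚ.- P) ⟩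
    ∣ D ℚ.- P ∣ ∎
    where
    D P : ℚ
    D = detℚ (shifted M (seq w t))
    P = ∏ (λ j → seq w t ℚ.+ seq (μ j) t)

p≤∣p∣ : ∀ p → p ℚ.≤ ∣ p ∣
p≤∣p∣ p with ℚ.≤-total 0ℚ p
... | inj₁ 0≤p = ℚ.≤-reflexive (sym (ℚ.0≤p⇒∣p∣≡p 0≤p))
... | inj₂ p≤0 = ℚ.≤-trans p≤0 (ℚ.0≤∣p∣ p)

∣p-q∣<ε⇒p<q+ε : ∀ p q {ε} → ∣ p ℚ.- q ∣ ℚ.< ε → p ℚ.< q ℚ.+ ε
∣p-q∣<ε⇒p<q+ε p q {ε} h =
  subst (ℚ._< q ℚ.+ ε) (solve 2 (λ p q → q :+ (p :- q) := p) refl p q)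
    (ℚ.+-monoʳ-< q (ℚ.≤-<-trans (p≤∣p∣ (p ℚ.- q)) h))
  where open +-*-Solver

∣p-q∣<ε⇒q<p+ε : ∀ p q {ε} → ∣ p ℚ.- q ∣ ℚ.< ε → q ℚ.< p ℚ.+ ε
∣p-q∣<ε⇒q<p+ε p q {ε} h = ∣p-q∣<ε⇒p<q+ε q p (subst (ℚ._< ε) (trans (sym (ℚ.∣-p∣≡∣p∣ (p ℚ.- q)))
    (cong ∣_∣ (solve 2 (λ p q → :- (p :- q) := q :- p) refl p q))) h)
  where open +-*-Solver

^-mono-≤ : ∀ {x y} → 0ℚ ℚ.≤ x → x ℚ.≤ y → ∀ n → x ^ℚ n ℚ.≤ y ^ℚ n
^-mono-≤ 0≤x x≤y zero    = ℚ.≤-refl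
^-mono-≤ 0≤x x≤y (suc n) = *-mono-≤ 0≤x (0≤^ 0≤x n) x≤y (^-mono-≤ 0≤x x≤y n)

-- At x = μ j the product vanishes identically, whereas |det| ≥ ηⁿ if μ j ≤ -η.
spectrum-nonNeg : ∀ {n} {M : Matrix ℤ n} {μ} → IsSpectrum M μ →
  (∀ y → DominantZMatrix y (shifted M y)) →
  ∀ {η} → 0ℚ ℚ.< η → ∀ j → Eventually λ t → ℚ.- η ℚ.< seq (μ j) t
spectrum-nonNeg {n} {M} {μ} spec dom {η} 0<η j = proj₁ atRoot , λ t le → large t (proj₂ atRoot t le)
  where
  P : ℕ → ℚ
  P t = ∏ (λ l → ℚ.- seq (μ j) t ℚ.+ seq (μ l) t)
  -- The tolerance equals the lower bound that `det-bounds` gives when the term of `μ j` is at most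
  -- `- η`, so the strict inequality is a contradiction.
  atRoot : Eventually λ t → ∣ detℚ (shifted M (ℚ.- seq (μ j) t)) ℚ.- P t ∣ ℚ.< η ^ℚ n
  atRoot = charpoly-shifted spec (-ℝ μ j) (0<^ 0<η n)
  P≡0 : ∀ t → P t ≡ 0ℚ
  P≡0 t = ∏-annihilated j (ℚ.+-inverseˡ (seq (μ j) t))
  large : ∀ t → ∣ detℚ (shifted M (ℚ.- seq (μ j) t)) ℚ.- P t ∣ ℚ.< η ^ℚ n → ℚ.- η ℚ.< seq (μ j) t
  large t h = ℚ.≰⇒> λ μ≤-η → ℚ.<-irrefl refl (small μ≤-η)
    where
    open import Algebra.Properties.Group ℚ.+-0-group using () renaming (⁻¹-involutive to neg-involutive)
    -- The shift is itself an approximation and varies with `t`, which is why `dom` is assumed for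
    -- all `y`.
    y : ℚ
    y = ℚ.- seq (μ j) t
    small : seq (μ j) t ℚ.≤ ℚ.- η → η ^ℚ n ℚ.< η ^ℚ n
    small μ≤-η = ℚ.≤-<-trans (^-mono-≤ (ℚ.<⇒≤ 0<η) η≤y n)
      (ℚ.≤-<-trans (proj₁ (det-bounds (ℚ.<-≤-trans 0<η η≤y) (dom y)))
        (subst (detℚ (shifted M y) ℚ.<_)
          (trans (cong (ℚ._+ η ^ℚ n) (P≡0 t)) (ℚ.+-identityˡ (η ^ℚ n)))
          (∣p-q∣<ε⇒p<q+ε (detℚ (shifted M y)) (P t) h)))
      where
      η≤y : η ℚ.≤ y
      η≤y = subst (ℚ._≤ y) (neg-involutive η) (ℚ.neg-antimono-≤ μ≤-η)

-- Comparing a product with its leading terms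

-- The two leading terms of the product, with an extra factor `y` on both sides to avoid the
-- exponent `n - 1`. Each inductive step discards a cross term `v * s`.
∏-lower : ∀ {n y} {ν : Vector ℚ n} → 0ℚ ℚ.≤ y → (∀ i → 0ℚ ℚ.≤ ν i) →
  y ^ℚ n ℚ.* (y ℚ.+ ∑ ν) ℚ.≤ y ℚ.* ∏ (λ i → y ℚ.+ ν i)
∏-lower {zero}  {y} {ν} 0≤y 0≤ν = ℚ.≤-reflexive (begin
  1ℚ ℚ.* (y ℚ.+ ∑ ν)          ≡⟨ cong (λ s → 1ℚ ℚ.* (y ℚ.+ s)) (∑-zero ν) ⟩
  1ℚ ℚ.* (y ℚ.+ 0ℚ)           ≡⟨ solve 1 (λ y → con 1ℚ :* (y :+ con 0ℚ) := y :* con 1ℚ) refl y ⟩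
  y ℚ.* 1ℚ                    ≡⟨ cong (y ℚ.*_) (sym (∏-zero _)) ⟩
  y ℚ.* ∏ (λ i → y ℚ.+ ν i)   ∎)
  where
  open ≡-Reasoning
  open +-*-Solver
∏-lower {suc n} {y} {ν} 0≤y 0≤ν = subst₂ ℚ._≤_ (cong (λ s → y ^ℚ suc n ℚ.* (y ℚ.+ s)) (sym (∑-suc ν)))
  (cong (y ℚ.*_) (sym (∏-suc _)))
  (begin
    y ^ℚ suc n ℚ.* (y ℚ.+ (v ℚ.+ s))
      ≤⟨ ≤-diff (0≤* (0≤^ 0≤y n) (0≤* (0≤ν zero) (∑-nonNeg (0≤ν ∘ suc))))
           (solve 4 (λ p y v s → y :* p :* (y :+ (v :+ s)) :+ p :* (v :* s) := (y :+ v) :* (p :* (y :+ s))) refl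
             (y ^ℚ n) y v s) ⟩
    (y ℚ.+ v) ℚ.* (y ^ℚ n ℚ.* (y ℚ.+ s))
      ≤⟨ ℚ.*-monoˡ-≤-nonNeg (y ℚ.+ v) {{ℚ.nonNegative (ℚ.+-mono-≤ 0≤y (0≤ν zero))}} (∏-lower 0≤y (0≤ν ∘ suc)) ⟩
    (y ℚ.+ v) ℚ.* (y ℚ.* P)
      ≡⟨ solve 3 (λ y v p → (y :+ v) :* (y :* p) := y :* ((y :+ v) :* p)) refl y v P ⟩
    y ℚ.* ((y ℚ.+ v) ℚ.* P) ∎)
  where
  open ℚ.≤-Reasoning
  open +-*-Solver
  v s P : ℚ
  v = ν zero
  s = ∑ (ν ∘ suc)
  P = ∏ (λ i → y ℚ.+ ν (suc i))

-- ∏ (1 + aᵢ/y) ≤ 1 / (1 - ∑ aᵢ/y), with denominators cleared.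
∏-upper : ∀ {n y} {a : Vector ℚ n} → 0ℚ ℚ.≤ y → (∀ i → 0ℚ ℚ.≤ a i) →
  ∏ (λ i → y ℚ.+ a i) ℚ.* (y ℚ.- ∑ a) ℚ.≤ y ^ℚ suc n
∏-upper {zero}  {y} {a} 0≤y 0≤a = ℚ.≤-reflexive (begin
  ∏ (λ i → y ℚ.+ a i) ℚ.* (y ℚ.- ∑ a)  ≡⟨ cong₂ (λ p s → p ℚ.* (y ℚ.- s)) (∏-zero _) (∑-zero a) ⟩
  1ℚ ℚ.* (y ℚ.- 0ℚ)                    ≡⟨ solve 1 (λ y → con 1ℚ :* (y :- con 0ℚ) := y :* con 1ℚ) refl y ⟩
  y ℚ.* 1ℚ                             ∎)
  where
  open ≡-Reasoning
  open +-*-Solver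
∏-upper {suc n} {y} {a} 0≤y 0≤a = subst (ℚ._≤ y ^ℚ suc (suc n))
  (sym (cong₂ (λ p s → p ℚ.* (y ℚ.- s)) (∏-suc _) (∑-suc a)))
  (begin
    ((y ℚ.+ b) ℚ.* P) ℚ.* (y ℚ.- (b ℚ.+ s))
      ≤⟨ ≤-diff (0≤* 0≤P (ℚ.+-mono-≤ (0≤* (0≤a zero) (∑-nonNeg (0≤a ∘ suc))) (0≤* (0≤a zero) (0≤a zero))))
           (solve 4 (λ y b s p → ((y :+ b) :* p) :* (y :- (b :+ s)) :+ p :* (b :* s :+ b :* b) :=
              y :* (p :* (y :- s))) refl y b s P) ⟩
    y ℚ.* (P ℚ.* (y ℚ.- s))
      ≤⟨ ℚ.*-monoˡ-≤-nonNeg y {{ℚ.nonNegative 0≤y}} (∏-upper 0≤y (0≤a ∘ suc)) ⟩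
    y ℚ.* y ^ℚ suc n ∎)
  where
  open ℚ.≤-Reasoning
  open +-*-Solver
  b s P : ℚ
  b = a zero
  s = ∑ (a ∘ suc)
  P = ∏ (λ i → y ℚ.+ a (suc i))
  0≤P : 0ℚ ℚ.≤ P
  0≤P = ∏-nonNeg λ i → ℚ.+-mono-≤ 0≤y (0≤a (suc i))

-- The coefficient of yⁿ⁻¹ is read off at a large argument y = ∑ a + z, where δ z = (∑ a)² + 1.
module _ {n} {a : Vector ℚ n} (0≤a : ∀ i → 0ℚ ℚ.≤ a i) {δ z y κ : ℚ} (0<z : 0ℚ ℚ.< z) (0<y : 0ℚ ℚ.< y)
         (y≡ : y ≡ ∑ a ℚ.+ z) (δz≡ : δ ℚ.* z ≡ ∑ a ℚ.* ∑ a ℚ.+ 1ℚ) (yzκ≡1 : (y ℚ.* z) ℚ.* κ ≡ 1ℚ)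
         {ν : Vector ℚ n} (0≤ν : ∀ i → 0ℚ ℚ.≤ ν i)
         (Q≤P+ε : ∏ (λ i → y ℚ.+ ν i) ℚ.≤ ∏ (λ i → y ℚ.+ a i) ℚ.+ y ^ℚ n ℚ.* κ) where

  open ℚ.≤-Reasoning
  open +-*-Solver

  private
    A s P Q : ℚ
    A = ∑ a
    s = ∑ ν
    P = ∏ (λ i → y ℚ.+ a i)
    Q = ∏ (λ i → y ℚ.+ ν i)

    0≤y : ℚ.NonNegative y
    0≤y = ℚ.nonNegative (ℚ.<⇒≤ 0<y)

    0≤z : ℚ.NonNegative z
    0≤z = ℚ.nonNegative (ℚ.<⇒≤ 0<z)

    z≡ : z ≡ y ℚ.- A
    z≡ = trans (solve 2 (λ a z → z := (a :+ z) :- a) refl A z) (cong (ℚ._- A) (sym y≡))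

    -- Multiplication by `y * z` turns the tolerance into exactly `y ^ℚ n`, which becomes the
    -- summand 1 after cancellation, while `z ≡ y - A` supplies the factor that `∏-upper` requires.
    [y+s]z≤ : (y ℚ.+ s) ℚ.* z ℚ.≤ y ℚ.* y ℚ.+ 1ℚ
    [y+s]z≤ = ℚ.*-cancelˡ-≤-pos (y ^ℚ n) {{ℚ.positive (0<^ 0<y n)}} (begin
      y ^ℚ n ℚ.* ((y ℚ.+ s) ℚ.* z)
        ≡⟨ sym (ℚ.*-assoc (y ^ℚ n) (y ℚ.+ s) z) ⟩
      y ^ℚ n ℚ.* (y ℚ.+ s) ℚ.* z
        ≤⟨ ℚ.*-monoʳ-≤-nonNeg z {{0≤z}} (∏-lower (ℚ.<⇒≤ 0<y) 0≤ν) ⟩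
      y ℚ.* Q ℚ.* z
        ≤⟨ ℚ.*-monoʳ-≤-nonNeg z {{0≤z}} (ℚ.*-monoˡ-≤-nonNeg y {{0≤y}} Q≤P+ε) ⟩
      y ℚ.* (P ℚ.+ y ^ℚ n ℚ.* κ) ℚ.* z
        ≡⟨ solve 5 (λ y p q k z → y :* (p :+ q :* k) :* z := y :* (p :* z) :+ q :* ((y :* z) :* k)) refl
             y P (y ^ℚ n) κ z ⟩
      y ℚ.* (P ℚ.* z) ℚ.+ y ^ℚ n ℚ.* ((y ℚ.* z) ℚ.* κ)
        ≡⟨ cong₂ (λ u v → y ℚ.* (P ℚ.* u) ℚ.+ y ^ℚ n ℚ.* v) z≡ yzκ≡1 ⟩
      y ℚ.* (P ℚ.* (y ℚ.- A)) ℚ.+ y ^ℚ n ℚ.* 1ℚ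
        ≤⟨ ℚ.+-monoˡ-≤ (y ^ℚ n ℚ.* 1ℚ) (ℚ.*-monoˡ-≤-nonNeg y {{0≤y}} (∏-upper (ℚ.<⇒≤ 0<y) 0≤a)) ⟩
      y ℚ.* (y ℚ.* y ^ℚ n) ℚ.+ y ^ℚ n ℚ.* 1ℚ
        ≡⟨ solve 2 (λ y q → y :* (y :* q) :+ q :* con 1ℚ := q :* (y :* y :+ con 1ℚ)) refl y (y ^ℚ n) ⟩
      y ^ℚ n ℚ.* (y ℚ.* y ℚ.+ 1ℚ) ∎)

  -- After `y * z` is subtracted, the excess over `A * z` is `A * A + 1`, and `z` is chosen to make
  -- this `δ * z`.
  ∑-bound : ∑ ν ℚ.≤ ∑ a ℚ.+ δ
  ∑-bound = ℚ.*-cancelʳ-≤-pos z {{ℚ.positive 0<z}} (begin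
    s ℚ.* z
      ≡⟨ solve 3 (λ s y z → s :* z := (y :+ s) :* z :- y :* z) refl s y z ⟩
    (y ℚ.+ s) ℚ.* z ℚ.- y ℚ.* z
      ≤⟨ ℚ.+-monoˡ-≤ (ℚ.- (y ℚ.* z)) [y+s]z≤ ⟩
    (y ℚ.* y ℚ.+ 1ℚ) ℚ.- y ℚ.* z
      ≡⟨ cong (λ x → (x ℚ.* x ℚ.+ 1ℚ) ℚ.- x ℚ.* z) y≡ ⟩
    ((A ℚ.+ z) ℚ.* (A ℚ.+ z) ℚ.+ 1ℚ) ℚ.- (A ℚ.+ z) ℚ.* z
      ≡⟨ solve 2 (λ a z → ((a :+ z) :* (a :+ z) :+ con 1ℚ) :- (a :+ z) :* z :=
           a :* z :+ (a :* a :+ con 1ℚ)) refl A z ⟩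
    A ℚ.* z ℚ.+ (A ℚ.* A ℚ.+ 1ℚ)
      ≡⟨ cong (A ℚ.* z ℚ.+_) (sym δz≡) ⟩
    A ℚ.* z ℚ.+ δ ℚ.* z
      ≡⟨ sym (ℚ.*-distribʳ-+ z A δ) ⟩
    (A ℚ.+ δ) ℚ.* z ∎)

-- The order of quantifiers matters: `y` and `ε` are fixed before `ν`, which will be made of
-- approximate eigenvalues at an index that depends on `y` and `ε`.
∏-≤⇒∑-≤ : ∀ {n} {a : Vector ℚ n} → (∀ i → 0ℚ ℚ.≤ a i) → ∀ {δ} → 0ℚ ℚ.< δ →
  ∃[ y ] ∃[ ε ] (0ℚ ℚ.< y × 0ℚ ℚ.< ε × (∀ {ν : Vector ℚ n} → (∀ i → 0ℚ ℚ.≤ ν i) →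
    ∏ (λ i → y ℚ.+ ν i) ℚ.≤ ∏ (λ i → y ℚ.+ a i) ℚ.+ ε → ∑ ν ℚ.≤ ∑ a ℚ.+ δ))
∏-≤⇒∑-≤ {n} {a} 0≤a {δ} 0<δ =
  y , y ^ℚ n ℚ.* κ , 0<y , 0<* (0<^ 0<y n) 0<κ , ∑-bound 0≤a 0<z 0<y refl δz≡ yzκ≡1
  where
  c z y κ : ℚ
  c = proj₁ (reciprocal 0<δ)
  -- The summand 1 pays for the tolerance and keeps `z` positive even when `∑ a` is zero.
  z = c ℚ.* (∑ a ℚ.* ∑ a ℚ.+ 1ℚ)
  y = ∑ a ℚ.+ z
  0≤A : 0ℚ ℚ.≤ ∑ a
  0≤A = ∑-nonNeg 0≤a
  0<z : 0ℚ ℚ.< z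
  0<z = 0<* (proj₁ (proj₂ (reciprocal 0<δ))) (ℚ.+-mono-≤-< (0≤* 0≤A 0≤A) (ℚ.positive⁻¹ 1ℚ))
  0<y : 0ℚ ℚ.< y
  0<y = ℚ.+-mono-≤-< 0≤A 0<z
  κ = proj₁ (reciprocal (0<* 0<y 0<z))
  0<κ : 0ℚ ℚ.< κ
  0<κ = proj₁ (proj₂ (reciprocal (0<* 0<y 0<z)))
  yzκ≡1 : (y ℚ.* z) ℚ.* κ ≡ 1ℚ
  yzκ≡1 = proj₂ (proj₂ (reciprocal (0<* 0<y 0<z)))
  δz≡ : δ ℚ.* z ≡ ∑ a ℚ.* ∑ a ℚ.+ 1ℚ
  δz≡ = trans (sym (ℚ.*-assoc δ c _))
    (trans (cong (ℚ._* (∑ a ℚ.* ∑ a ℚ.+ 1ℚ)) (proj₂ (proj₂ (reciprocal 0<δ)))) (ℚ.*-identityˡ _))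

-- The Laplacian

-- The gcd that normalises `i / 1` does not reduce for a variable `i`. In constructor form numerator
-- and denominator are visible, and the ring operations compute.
i/1≡mkℚ : ∀ i → i / 1 ≡ mkℚ i 0 (Coprimality.sym (1-coprimeTo ℤ.∣ i ∣))
i/1≡mkℚ i = ℚ.↥p/↧p≡p (mkℚ i 0 (Coprimality.sym (1-coprimeTo ℤ.∣ i ∣)))

/1-homo-+ : ∀ i j → (i ℤ.+ j) / 1 ≡ i / 1 ℚ.+ j / 1
/1-homo-+ i j = trans
  (cong₂ (λ a b → (a ℤ.+ b) / 1) (sym (ℤ.*-identityʳ i)) (sym (ℤ.*-identityʳ j)))
  (sym (cong₂ ℚ._+_ (i/1≡mkℚ i) (i/1≡mkℚ j)))

/1-homo-* : ∀ i j → (i ℤ.* j) / 1 ≡ i / 1 ℚ.* (j / 1)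
/1-homo-* i j = sym (cong₂ ℚ._*_ (i/1≡mkℚ i) (i/1≡mkℚ j))

/1-homo-neg : ∀ i → (ℤ.- i) / 1 ≡ ℚ.- (i / 1)
/1-homo-neg i = trans (i/1≡mkℚ (ℤ.- i)) (trans (neg i) (cong ℚ.-_ (sym (i/1≡mkℚ i))))
  where
  neg : ∀ i → mkℚ (ℤ.- i) 0 (Coprimality.sym (1-coprimeTo ℤ.∣ ℤ.- i ∣)) ≡
              ℚ.- mkℚ i 0 (Coprimality.sym (1-coprimeTo ℤ.∣ i ∣))
  neg (+ zero)  = refl
  neg (+ suc n) = refl
  neg -[1+ n ]  = refl

opaque
  ι : ℕ → ℚ
  ι n = + n / 1

  ι-def : ∀ n → ι n ≡ + n / 1
  ι-def n = refl

  ι-0 : ι 0 ≡ 0ℚ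
  ι-0 = refl

  ι-1 : ι 1 ≡ 1ℚ
  ι-1 = refl

  ι-+ : ∀ a b → ι (a + b) ≡ ι a ℚ.+ ι b
  ι-+ a b = /1-homo-+ (+ a) (+ b)

  ι-* : ∀ a b → ι (a * b) ≡ ι a ℚ.* ι b
  ι-* a b = trans (cong (_/ 1) (ℤ.pos-* a b)) (/1-homo-* (+ a) (+ b))

  ι-∸ : ∀ a b → (+ a ℤ.- + b) / 1 ≡ ι a ℚ.- ι b
  ι-∸ a b = trans (/1-homo-+ (+ a) (ℤ.- + b)) (cong (+ a / 1 ℚ.+_) (/1-homo-neg (+ b)))

  ι-mono-≤ : ∀ {a b} → a ≤ b → ι a ℚ.≤ ι b
  ι-mono-≤ {a} {b} a≤b = subst₂ ℚ._≤_ (sym (i/1≡mkℚ (+ a))) (sym (i/1≡mkℚ (+ b)))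
    (ℚ.*≤* (ℤ.*-monoʳ-≤-nonNeg (+ 1) (ℤ.+≤+ a≤b)))

0≤ι : ∀ n → 0ℚ ℚ.≤ ι n
0≤ι n = subst (ℚ._≤ ι n) ι-0 (ι-mono-≤ ℕ.z≤n)

∑-ι : ∀ {n} (f : Vector ℕ n) → ∑ (λ i → ι (f i)) ≡ ι (ℕSum.sum f)
∑-ι {zero}  f = trans (∑-zero _) (sym ι-0)
∑-ι {suc n} f = trans (∑-suc _) (trans (cong (ι (f zero) ℚ.+_) (∑-ι (f ∘ suc))) (sym (ι-+ (f zero) _)))

∑-const : ∀ n x → ∑ {n} (λ _ → x) ≡ ι n ℚ.* x
∑-const zero    x = trans (∑-zero _) (sym (trans (cong (ℚ._* x) ι-0) (ℚ.*-zeroˡ x)))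
∑-const (suc n) x = begin
  ∑ {suc n} (λ _ → x)       ≡⟨ trans (∑-suc _) (cong (x ℚ.+_) (∑-const n x)) ⟩
  x ℚ.+ ι n ℚ.* x           ≡⟨ solve 2 (λ x n → x :+ n :* x := (con 1ℚ :+ n) :* x) refl x (ι n) ⟩
  (1ℚ ℚ.+ ι n) ℚ.* x        ≡⟨ cong (λ o → (o ℚ.+ ι n) ℚ.* x) (sym ι-1) ⟩
  (ι 1 ℚ.+ ι n) ℚ.* x       ≡⟨ cong (ℚ._* x) (sym (ι-+ 1 n)) ⟩
  ι (suc n) ℚ.* x           ∎
  where
  open ≡-Reasoning
  open +-*-Solver

∑-indicator : ∀ {n} (i : Fin n) x → ∑ (λ j → if does (i Fin.≟ j) then x else 0ℚ) ≡ x
∑-indicator zero    x = trans (∑-suc _) (trans (cong (x ℚ.+_) (∑-const-0 _)) (ℚ.+-identityʳ x))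
∑-indicator (suc i) x = trans (∑-suc _) (trans (ℚ.+-identityˡ _) (∑-indicator i x))

∑-inject≤ : ∀ {k n} .(k≤n : k ≤ n) {f : Vector ℚ n} → (∀ i → 0ℚ ℚ.≤ f i) →
  ∑ (λ (i : Fin k) → f (inject≤ i k≤n)) ℚ.≤ ∑ f
∑-inject≤ {zero}          k≤n {f} 0≤f = subst (ℚ._≤ ∑ f) (sym (∑-zero _)) (∑-nonNeg 0≤f)
∑-inject≤ {suc k} {suc n} k≤n {f} 0≤f = subst₂ ℚ._≤_ (sym (∑-suc _)) (sym (∑-suc f))
  (ℚ.+-monoʳ-≤ (f zero) (∑-inject≤ (ℕ.s≤s⁻¹ k≤n) (0≤f ∘ suc)))

module _ {n} (G : SimpleGraph n) where
  open SimpleGraph G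

  orientedEdge : Matrix ℕ n
  orientedEdge i j = if does (i Fin.<? j) ∧ does (adj? i j) then 1 else 0

  -- Off the diagonal exactly one of the two orientations is counted, and symmetry of adjacency
  -- makes the truth values agree; on the diagonal everything is zero.
  adjacency-split : ∀ i j → adjacency G i j ≡ orientedEdge i j + orientedEdge j i
  adjacency-split i j with Fin.<-cmp i j
  ... | tri< i<j _ j≮i rewrite dec-true (i Fin.<? j) i<j | dec-false (j Fin.<? i) j≮i = sym (ℕ.+-identityʳ _)
  ... | tri≈ _ refl _ rewrite dec-false (adj? i i) irrefl | ∧-zeroʳ (does (i Fin.<? i)) = refl
  ... | tri> i≮j _ j<i rewrite dec-true (j Fin.<? i) j<i | dec-false (i Fin.<? j) i≮j =
    cong (λ b → if b then 1 else 0) (does-⇔ (mk⇔ symm symm) (adj? i j) (adj? j i))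

  handshake : ℕSum.sum (degree G) ≡ edgeCount G + edgeCount G
  handshake = begin
    ℕSum.sum (λ i → ℕSum.sum (adjacency G i))
      ≡⟨ ℕSum.sum-cong-≗ {x = degree G} (λ i → trans
           (ℕSum.sum-cong-≗ {x = adjacency G i} (adjacency-split i))
           (ℕSum.∑-distrib-+ (orientedEdge i) (λ j → orientedEdge j i))) ⟩
    ℕSum.sum (λ i → ℕSum.sum (orientedEdge i) + ℕSum.sum (λ j → orientedEdge j i))
      ≡⟨ ℕSum.∑-distrib-+ (λ i → ℕSum.sum (orientedEdge i)) (λ i → ℕSum.sum (λ j → orientedEdge j i)) ⟩
    edgeCount G + ℕSum.sum (λ i → ℕSum.sum (λ j → orientedEdge j i))
      ≡⟨ cong (λ x → edgeCount G + x) (ℕSum.∑-comm (λ i j → orientedEdge j i)) ⟩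
    edgeCount G + edgeCount G ∎
    where open ≡-Reasoning

  -- Puts `y` and the degree under a single test of `i ≟ j`, the form in which `∑-indicator`
  -- evaluates the row sum.
  shifted-laplacian : ∀ y i j → shifted (laplacian G) y i j ≡
    (if does (i Fin.≟ j) then y ℚ.+ ι (degree G i) else 0ℚ) ℚ.- ι (adjacency G i j)
  shifted-laplacian y i j = entry (does (i Fin.≟ j))
    where
    d a : ℕ
    d = degree G i
    a = adjacency G i j
    entry : ∀ b → (if b then y else 0ℚ) ℚ.+ (+ (if b then d else 0) ℤ.- + a) / 1 ≡
                  (if b then y ℚ.+ ι d else 0ℚ) ℚ.- ι a
    entry true  = trans (cong (y ℚ.+_) (ι-∸ d a)) (sym (ℚ.+-assoc y (ι d) (ℚ.- ι a)))
    entry false = cong (0ℚ ℚ.+_) (trans (ι-∸ 0 a) (trans (cong (ℚ._- ι a) ι-0) (ℚ.+-identityˡ (ℚ.- ι a))))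

  -- The rows of the Laplacian sum to zero, so the row sums are exactly `y`, whatever its sign.
  laplacian-dominant : ∀ y → DominantZMatrix y (shifted (laplacian G) y)
  laplacian-dominant y = record
    { offDiagonal = λ i j i≢j → ≤-diff (0≤ι (adjacency G i j)) (begin
        shifted (laplacian G) y i j ℚ.+ ι (adjacency G i j)
          ≡⟨ cong (ℚ._+ ι (adjacency G i j)) (shifted-laplacian y i j) ⟩
        diagonal i j ℚ.- ι (adjacency G i j) ℚ.+ ι (adjacency G i j)
          ≡⟨ cong (λ b → (if b then y ℚ.+ ι (degree G i) else 0ℚ) ℚ.- ι (adjacency G i j) ℚ.+ ι (adjacency G i j))
               (dec-false (i Fin.≟ j) i≢j) ⟩
        0ℚ ℚ.- ι (adjacency G i j) ℚ.+ ι (adjacency G i j)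
          ≡⟨ solve 1 (λ a → con 0ℚ :- a :+ a := con 0ℚ) refl (ι (adjacency G i j)) ⟩
        0ℚ ∎)
    ; rowSum = λ i → ℚ.≤-reflexive (sym (begin
        ∑ (shifted (laplacian G) y i)
          ≡⟨ ∑-cong (λ j → trans (shifted-laplacian y i j)
               (cong (diagonal i j ℚ.+_) (-x≡-1*x (ι (adjacency G i j))))) ⟩
        ∑ (λ j → diagonal i j ℚ.+ (ℚ.- 1ℚ) ℚ.* ι (adjacency G i j))
          ≡⟨ trans (∑-+ (diagonal i) _) (cong₂ ℚ._+_ (∑-indicator i _) (sym (∑-*ˡ (ℚ.- 1ℚ) _))) ⟩
        (y ℚ.+ ι (degree G i)) ℚ.+ (ℚ.- 1ℚ) ℚ.* ∑ (λ j → ι (adjacency G i j))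
          ≡⟨ cong (λ s → (y ℚ.+ ι (degree G i)) ℚ.+ (ℚ.- 1ℚ) ℚ.* s) (∑-ι (adjacency G i)) ⟩
        (y ℚ.+ ι (degree G i)) ℚ.+ (ℚ.- 1ℚ) ℚ.* ι (degree G i)
          ≡⟨ solve 2 (λ y d → (y :+ d) :+ con (ℚ.- 1ℚ) :* d := y) refl y (ι (degree G i)) ⟩
        y ∎))
    }
    where
    open ≡-Reasoning
    open +-*-Solver
    diagonal : Matrix ℚ n
    diagonal i j = if does (i Fin.≟ j) then y ℚ.+ ι (degree G i) else 0ℚ
    -x≡-1*x : ∀ x → ℚ.- x ≡ (ℚ.- 1ℚ) ℚ.* x
    -x≡-1*x = solve 1 (λ x → :- x := con (ℚ.- 1ℚ) :* x) refl

  laplacian-diagonal : ∀ y i → shifted (laplacian G) y i i ℚ.≤ y ℚ.+ ι (degree G i)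
  laplacian-diagonal y i = ≤-diff (0≤ι (adjacency G i i)) (begin
    shifted (laplacian G) y i i ℚ.+ ι (adjacency G i i)
      ≡⟨ cong (ℚ._+ ι (adjacency G i i)) (shifted-laplacian y i i) ⟩
    (if does (i Fin.≟ i) then y ℚ.+ ι (degree G i) else 0ℚ) ℚ.- ι (adjacency G i i) ℚ.+ ι (adjacency G i i)
      ≡⟨ cong (λ b → (if b then y ℚ.+ ι (degree G i) else 0ℚ) ℚ.- ι (adjacency G i i) ℚ.+ ι (adjacency G i i))
           (dec-true (i Fin.≟ i) refl) ⟩
    (y ℚ.+ ι (degree G i)) ℚ.- ι (adjacency G i i) ℚ.+ ι (adjacency G i i)
      ≡⟨ solve 2 (λ x a → x :- a :+ a := x) refl (y ℚ.+ ι (degree G i)) (ι (adjacency G i i)) ⟩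
    y ℚ.+ ι (degree G i) ∎)
    where
    open ≡-Reasoning
    open +-*-Solver

  module _ {μ : Vector ℝ n} (spec : IsSpectrum (laplacian G) μ) where

    -- Half of `ε` is the slack `δ` of the comparison of products; the other half covers the
    -- increase by `η` in each of the `n` rows.
    eigenvalueSum-≤ : ∀ {k} .(k≤n : k ≤ n) {ε} → 0ℚ ℚ.< ε →
      Eventually λ t → seq (S k k≤n μ) t ℚ.≤ ι (edgeCount G + edgeCount G) ℚ.+ ε
    eigenvalueSum-≤ {k} k≤n {ε} 0<ε = proj₁ both , λ t le → bound t (proj₁ (proj₂ both t le)) (proj₂ (proj₂ both t le))
      where
      δ η : ℚ
      δ = ½ ℚ.* ε
      0<δ : 0ℚ ℚ.< δ
      0<δ = 0<* (ℚ.positive⁻¹ ½) 0<ε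
      0<ι[1+n] : 0ℚ ℚ.< ι (suc n)
      0<ι[1+n] = ℚ.<-≤-trans (ℚ.positive⁻¹ 1ℚ) (subst (ℚ._≤ ι (suc n)) ι-1 (ι-mono-≤ (ℕ.s≤s ℕ.z≤n)))
      -- The reciprocal of `suc n` instead of `n` also exists for `n = 0`, and still gives
      -- `n * η ≤ δ`.
      c : ℚ
      c = proj₁ (reciprocal 0<ι[1+n])
      η = δ ℚ.* c
      0<η : 0ℚ ℚ.< η
      0<η = 0<* 0<δ (proj₁ (proj₂ (reciprocal 0<ι[1+n])))
      -- The approximate eigenvalues are only known to exceed `- η`. Evaluating at `y + η` lets the
      -- degrees and the eigenvalues each absorb one `η`, which makes the latter nonnegative.
      a : Vector ℚ n
      a i = ι (degree G i) ℚ.+ η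
      0≤a : ∀ i → 0ℚ ℚ.≤ a i
      0≤a i = ℚ.+-mono-≤ (0≤ι (degree G i)) (ℚ.<⇒≤ 0<η)
      comparison : ∃[ y ] ∃[ ε ] (0ℚ ℚ.< y × 0ℚ ℚ.< ε × (∀ {ν : Vector ℚ n} → (∀ i → 0ℚ ℚ.≤ ν i) →
        ∏ (λ i → y ℚ.+ ν i) ℚ.≤ ∏ (λ i → y ℚ.+ a i) ℚ.+ ε → ∑ ν ℚ.≤ ∑ a ℚ.+ δ))
      comparison = ∏-≤⇒∑-≤ 0≤a 0<δ
      y ε′ : ℚ
      y = proj₁ comparison
      ε′ = proj₁ (proj₂ comparison)
      0<y : 0ℚ ℚ.< y
      0<y = proj₁ (proj₂ (proj₂ comparison))
      -- The argument is a constant sequence, so this determinant is the same for every `t`.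
      D : ℚ
      D = detℚ (shifted (laplacian G) (y ℚ.+ η))
      both : Eventually λ t → (∀ i → ℚ.- η ℚ.< seq (μ i) t) ×
               ∣ D ℚ.- ∏ (λ j → (y ℚ.+ η) ℚ.+ seq (μ j) t) ∣ ℚ.< ε′
      both = eventually-∀ {P = λ i t → ℚ.- η ℚ.< seq (μ i) t} (spectrum-nonNeg spec laplacian-dominant 0<η) ∩
             charpoly-shifted spec (fromℚ (y ℚ.+ η)) (proj₁ (proj₂ (proj₂ (proj₂ comparison))))
      D≤ : D ℚ.≤ ∏ (λ i → y ℚ.+ a i)
      D≤ = ℚ.≤-trans (proj₂ (det-bounds 0<y+η dom))
        (∏-mono-≤ (λ i → ℚ.≤-trans (ℚ.<⇒≤ 0<y+η) (diagonal-≥ dom i))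
          (λ i → ℚ.≤-trans (laplacian-diagonal (y ℚ.+ η) i)
            (ℚ.≤-reflexive (solve 3 (λ y h d → (y :+ h) :+ d := y :+ (d :+ h)) refl y η (ι (degree G i))))))
        where
        open +-*-Solver
        0<y+η : 0ℚ ℚ.< y ℚ.+ η
        0<y+η = ℚ.+-mono-< 0<y 0<η
        dom : DominantZMatrix (y ℚ.+ η) (shifted (laplacian G) (y ℚ.+ η))
        dom = laplacian-dominant (y ℚ.+ η)
      nη≤δ : ι n ℚ.* η ℚ.≤ δ
      nη≤δ = begin
        ι n ℚ.* η
          ≤⟨ ℚ.*-monoʳ-≤-nonNeg η {{ℚ.nonNegative (ℚ.<⇒≤ 0<η)}} (ι-mono-≤ (ℕ.n≤1+n n)) ⟩
        ι (suc n) ℚ.* (δ ℚ.* c)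
          ≡⟨ solve 3 (λ n d c → n :* (d :* c) := d :* (n :* c)) refl (ι (suc n)) δ c ⟩
        δ ℚ.* (ι (suc n) ℚ.* c)
          ≡⟨ cong (δ ℚ.*_) (proj₂ (proj₂ (reciprocal 0<ι[1+n]))) ⟩
        δ ℚ.* 1ℚ
          ≡⟨ ℚ.*-identityʳ δ ⟩
        δ ∎
        where
        open ℚ.≤-Reasoning
        open +-*-Solver
      bound : ∀ t → (∀ i → ℚ.- η ℚ.< seq (μ i) t) → ∣ D ℚ.- ∏ (λ j → (y ℚ.+ η) ℚ.+ seq (μ j) t) ∣ ℚ.< ε′ →
              seq (S k k≤n μ) t ℚ.≤ ι (edgeCount G + edgeCount G) ℚ.+ ε
      bound t -η<μ D≈∏ = begin
        seq (S k k≤n μ) t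
          ≡⟨ seq-sum (λ (i : Fin k) → μ (inject≤ i k≤n)) t ⟩
        ∑ (λ (i : Fin k) → seq (μ (inject≤ i k≤n)) t)
          ≤⟨ ∑-mono-≤ (λ (i : Fin k) → ≤-diff (ℚ.<⇒≤ 0<η) refl) ⟩
        ∑ (λ (i : Fin k) → ν (inject≤ i k≤n))
          ≤⟨ ∑-inject≤ k≤n 0≤ν ⟩
        ∑ ν
          ≤⟨ proj₂ (proj₂ (proj₂ (proj₂ comparison))) 0≤ν ∏ν≤ ⟩
        ∑ a ℚ.+ δ
          ≡⟨ cong (ℚ._+ δ) (trans (∑-+ _ _) (cong₂ ℚ._+_ (trans (∑-ι (degree G)) (cong ι handshake)) (∑-const n η))) ⟩
        ι (edgeCount G + edgeCount G) ℚ.+ ι n ℚ.* η ℚ.+ δ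
          ≤⟨ ℚ.+-monoˡ-≤ δ (ℚ.+-monoʳ-≤ (ι (edgeCount G + edgeCount G)) nη≤δ) ⟩
        ι (edgeCount G + edgeCount G) ℚ.+ δ ℚ.+ δ
          ≡⟨ solve 2 (λ m e → m :+ con ½ :* e :+ con ½ :* e := m :+ e) refl (ι (edgeCount G + edgeCount G)) ε ⟩
        ι (edgeCount G + edgeCount G) ℚ.+ ε ∎
        where
        open ℚ.≤-Reasoning
        open +-*-Solver
        ν : Vector ℚ n
        ν i = seq (μ i) t ℚ.+ η
        0≤ν : ∀ i → 0ℚ ℚ.≤ ν i
        0≤ν i = subst (ℚ._≤ ν i) (ℚ.+-inverseˡ η) (ℚ.+-monoˡ-≤ η (ℚ.<⇒≤ (-η<μ i)))
        ∏ν≤ : ∏ (λ i → y ℚ.+ ν i) ℚ.≤ ∏ (λ i → y ℚ.+ a i) ℚ.+ ε′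
        ∏ν≤ = begin
          ∏ (λ i → y ℚ.+ ν i)
            ≡⟨ ∏-cong (λ i → solve 3 (λ y h u → y :+ (u :+ h) := (y :+ h) :+ u) refl y η (seq (μ i) t)) ⟩
          ∏ (λ i → (y ℚ.+ η) ℚ.+ seq (μ i) t)
            ≤⟨ ℚ.<⇒≤ (∣p-q∣<ε⇒q<p+ε D _ D≈∏) ⟩
          D ℚ.+ ε′
            ≤⟨ ℚ.+-monoˡ-≤ ε′ D≤ ⟩
          ∏ (λ i → y ℚ.+ a i) ℚ.+ ε′ ∎

-- The bound on m

-- Approximations to a nonnegative root may be negative, so `x` carries no sign condition; a
-- negative `x` has a nonpositive cube.
cube-mono-≤ : ∀ {x y} → 0ℚ ℚ.≤ y → x ℚ.≤ y → x ^ℚ 3 ℚ.≤ y ^ℚ 3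
cube-mono-≤ {x} {y} 0≤y x≤y with ℚ.≤-total 0ℚ x
... | inj₁ 0≤x = ^-mono-≤ 0≤x x≤y 3
... | inj₂ x≤0 = ℚ.≤-trans
    (≤-diff (0≤^ (neg-≤0 x≤0) 3)
      (solve 1 (λ x → x :* (x :* (x :* con 1ℚ)) :+ (:- x) :* ((:- x) :* ((:- x) :* con 1ℚ)) := con 0ℚ) refl x))
    (0≤^ 0≤y 3)
  where open +-*-Solver

ι-^ : ∀ a n → ι (a ^ n) ≡ ι a ^ℚ n
ι-^ a zero    = ι-1
ι-^ a (suc n) = trans (ι-* a (a ^ n)) (cong (ι a ℚ.*_) (ι-^ a n))

⅛ : ℚ
⅛ = + 1 / 8

-- The summand n² absorbs the error of approximating the root within ⅛.
cube-slack : ∀ {x y} → 0ℚ ℚ.≤ x → x ℚ.≤ y → 1ℚ ℚ.≤ y → (x ℚ.+ ⅛) ^ℚ 3 ℚ.+ ⅛ ℚ.≤ x ^ℚ 3 ℚ.+ y ^ℚ 2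
cube-slack {x} {y} 0≤x x≤y 1≤y = ≤-diff
  -- Expanded, the left side exceeds the cube of `x` by 3/8 x² + 3/64 x + 65/512. Each of x², x and
  -- 1 is at most y², so this uses 281/512 of y² and leaves 231/512.
  (ℚ.+-mono-≤ (0≤* (ℚ.nonNegative⁻¹ (+ 3 / 8)) (0≤diff x²≤y²))
    (ℚ.+-mono-≤ (0≤* (ℚ.nonNegative⁻¹ (+ 3 / 64)) (0≤diff x≤y²))
      (ℚ.+-mono-≤ (0≤* (ℚ.nonNegative⁻¹ (+ 65 / 512)) (0≤diff 1≤y²))
        (0≤* (ℚ.nonNegative⁻¹ (+ 231 / 512)) (0≤* 0≤y 0≤y)))))
  (solve 2 (λ x y →
      let x+⅛ = x :+ con ⅛ in
      (x+⅛ :* (x+⅛ :* (x+⅛ :* con 1ℚ)) :+ con ⅛) :+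
        (con (+ 3 / 8) :* (y :* y :- x :* x) :+
          (con (+ 3 / 64) :* (y :* y :- con 1ℚ :* x) :+
            (con (+ 65 / 512) :* (y :* y :- con 1ℚ :* con 1ℚ) :+ con (+ 231 / 512) :* (y :* y)))) :=
      x :* (x :* (x :* con 1ℚ)) :+ y :* (y :* con 1ℚ)) refl x y)
  where
  open +-*-Solver
  0≤1 : 0ℚ ℚ.≤ 1ℚ
  0≤1 = ℚ.nonNegative⁻¹ 1ℚ
  0≤y : 0ℚ ℚ.≤ y
  0≤y = ℚ.≤-trans 0≤x x≤y
  0≤diff : ∀ {p q} → p ℚ.≤ q → 0ℚ ℚ.≤ q ℚ.- p
  0≤diff {p} {q} p≤q = subst (ℚ._≤ q ℚ.- p) (ℚ.+-inverseʳ p) (ℚ.+-monoˡ-≤ (ℚ.- p) p≤q)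
  x²≤y² : x ℚ.* x ℚ.≤ y ℚ.* y
  x²≤y² = *-mono-≤ 0≤x 0≤x x≤y x≤y
  x≤y² : 1ℚ ℚ.* x ℚ.≤ y ℚ.* y
  x≤y² = *-mono-≤ 0≤1 0≤x 1≤y x≤y
  1≤y² : 1ℚ ℚ.* 1ℚ ℚ.≤ y ℚ.* y
  1≤y² = *-mono-≤ 0≤1 0≤1 1≤y 1≤y

-- Applied with `b = 4 * m * n` and `q` the fraction under the root. Because `n ^ 2` leaves room for
-- the error, a single late term of the sequence decides this comparison of natural numbers.
cubeRoot-≤ : ∀ {q b k n r} → 0ℚ ℚ.≤ q → IsRoot 3 (fromℚ q +ℝ fromℕ (b + n ^ 2)) r → r ≤ℝ fromℕ k →
  k ≤ n → 1 ≤ n → b ≤ k ^ 3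
cubeRoot-≤ {q} {b} {k} {n} {r} 0≤q root r≤k k≤n 1≤n = ℕ.≮⇒≥ λ k³<b →
  ℚ.<-irrefl refl (ℚ.<-≤-trans b+n²<k³+n² (ℚ.+-monoˡ-≤ (ι n ^ℚ 2) (ι-mono-≤ (ℕ.<⇒≤ k³<b))))
  where
  open ℚ.≤-Reasoning
  0<⅛ : 0ℚ ℚ.< ⅛
  0<⅛ = ℚ.positive⁻¹ ⅛
  t : ℕ
  t = proj₁ (below r≤k ⅛ 0<⅛) ℕ.⊔ proj₁ (close (IsRoot.power root) ⅛ 0<⅛)
  r<k+⅛ : seq r t ℚ.< ι k ℚ.+ ⅛
  r<k+⅛ = subst (λ x → seq r t ℚ.< x ℚ.+ ⅛) (sym (ι-def k))
    (proj₂ (below r≤k ⅛ 0<⅛) t (ℕ.m≤m⊔n _ _))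
  b+n²<r³+⅛ : q ℚ.+ ι (b + n ^ 2) ℚ.< seq r t ^ℚ 3 ℚ.+ ⅛
  b+n²<r³+⅛ = subst (λ x → q ℚ.+ x ℚ.< seq r t ^ℚ 3 ℚ.+ ⅛) (sym (ι-def (b + n ^ 2)))
    (∣p-q∣<ε⇒q<p+ε (seq r t ^ℚ 3) _ (proj₂ (close (IsRoot.power root) ⅛ 0<⅛) t (ℕ.m≤n⊔m _ _)))
  b+n²<k³+n² : ι b ℚ.+ ι n ^ℚ 2 ℚ.< ι (k ^ 3) ℚ.+ ι n ^ℚ 2
  b+n²<k³+n² = begin-strict
    ι b ℚ.+ ι n ^ℚ 2                ≡⟨ trans (cong (ι b ℚ.+_) (sym (ι-^ n 2))) (sym (ι-+ b (n ^ 2))) ⟩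
    ι (b + n ^ 2)                 ≡⟨ sym (ℚ.+-identityˡ _) ⟩
    0ℚ ℚ.+ ι (b + n ^ 2)          ≤⟨ ℚ.+-monoˡ-≤ (ι (b + n ^ 2)) 0≤q ⟩
    q ℚ.+ ι (b + n ^ 2)           <⟨ b+n²<r³+⅛ ⟩
    seq r t ^ℚ 3 ℚ.+ ⅛
      ≤⟨ ℚ.+-monoˡ-≤ ⅛ (cube-mono-≤ (ℚ.+-mono-≤ (0≤ι k) (ℚ.<⇒≤ 0<⅛)) (ℚ.<⇒≤ r<k+⅛)) ⟩
    (ι k ℚ.+ ⅛) ^ℚ 3 ℚ.+ ⅛
      ≤⟨ cube-slack (0≤ι k) (ι-mono-≤ k≤n) (subst (ℚ._≤ ι n) ι-1 (ι-mono-≤ 1≤n)) ⟩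
    ι k ^ℚ 3 ℚ.+ ι n ^ℚ 2            ≡⟨ cong (ℚ._+ ι n ^ℚ 2) (sym (ι-^ k 3)) ⟩
    ι (k ^ 3) ℚ.+ ι n ^ℚ 2         ∎

2*[1+k]C2≡[1+k]*k : ∀ k → 2 * ((k + 1) C 2) ≡ (k + 1) * k
2*[1+k]C2≡[1+k]*k zero    = refl
2*[1+k]C2≡[1+k]*k (suc k) = begin
  2 * (suc (k + 1) C 2)                    ≡⟨ cong (2 *_) (sym (nCk+nC[k+1]≡[n+1]C[k+1] (k + 1) 1)) ⟩
  2 * ((k + 1) C 1 + (k + 1) C 2)          ≡⟨ ℕ.*-distribˡ-+ 2 ((k + 1) C 1) ((k + 1) C 2) ⟩
  2 * ((k + 1) C 1) + 2 * ((k + 1) C 2)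
    ≡⟨ cong₂ (λ a b → 2 * a + b) (nC1≡n (k + 1)) (2*[1+k]C2≡[1+k]*k k) ⟩
  2 * (k + 1) + (k + 1) * k
    ≡⟨ solve 1 (λ k → con 2 :* (k :+ con 1) :+ (k :+ con 1) :* k := (con 1 :+ (k :+ con 1)) :* (con 1 :+ k)) refl k ⟩
  suc (k + 1) * suc k                      ∎
  where
  open ≡-Reasoning
  open ℕ-Solver.+-*-Solver

edges-≤-binomial : ∀ {m n k} .{{_ : NonZero n}} → k ≤ n → 4 * m * n ≤ k ^ 3 → m ≤ (k + 1) C 2
edges-≤-binomial {m} {n} {k} k≤n 4mn≤k³ = ℕ.*-cancelˡ-≤ 2 (begin
  2 * m              ≤⟨ ℕ.*-monoˡ-≤ m (ℕ.m≤m+n 2 2) ⟩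
  4 * m              ≤⟨ ℕ.*-cancelʳ-≤ (4 * m) (k * k) n 4mn≤k²n ⟩
  k * k              ≤⟨ ℕ.*-monoˡ-≤ k (ℕ.m≤m+n k 1) ⟩
  (k + 1) * k        ≡⟨ sym (2*[1+k]C2≡[1+k]*k k) ⟩
  2 * ((k + 1) C 2)  ∎)
  where
  open ℕ.≤-Reasoning
  4mn≤k²n : 4 * m * n ≤ k * k * n
  4mn≤k²n = begin
    4 * m * n    ≤⟨ 4mn≤k³ ⟩
    k ^ 3       ≡⟨ trans (cong (λ x → k * (k * x)) (ℕ.*-identityʳ k)) (sym (ℕ.*-assoc k k k)) ⟩
    k * k * k    ≤⟨ ℕ.*-monoʳ-≤ (k * k) k≤n ⟩
    k * k * n    ∎

n∸1≢0⇒n≢0 : ∀ n .{{_ : NonZero (n ∸ 1)}} → NonZero n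
n∸1≢0⇒n≢0 (suc n) = _

theorem5 : (n : ℕ) .{{_ : NonZero (n ∸ 1)}} (G : SimpleGraph n) (m : ℕ) → m ≡ edgeCount G →
    n ≤ m →
    (√3 : ℝ) → IsRoot 2 (fromℕ 3) √3 →
    fromℕ m ≤ℝ (√3 -ℝ fromℕ 1) *ℝ fromℚ (+ 1 / 4) *ℝ fromℕ (n ∸ 1) *ℝ fromℕ n →
    (μ : Vector ℝ n) → IsSpectrum (laplacian G) μ →
    (r : ℝ) → IsRoot 3 (fromℚ (+ (8 * m ^ 2) / (n ∸ 1)) +ℝ fromℕ (4 * m * n + n ^ 2)) r →
    (k : ℕ) → r ≤ℝ fromℕ k → (k≤n : k ≤ n) →
    S k k≤n μ ≤ℝ fromℕ (m + (k + 1) C 2)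
theorem5 n G m refl _ _ _ _ μ spec r root k r≤k k≤n = mk≤ λ ε 0<ε →
  -- The order on `ℝ` asks for a strict inequality, so the eigenvalue bound is taken with half of
  -- `ε`.
  let N , S≤2m = eigenvalueSum-≤ G spec k≤n (0<* (ℚ.positive⁻¹ ½) 0<ε) in
  N , λ t N≤t → begin-strict
    seq (S k k≤n μ) t              ≤⟨ S≤2m t N≤t ⟩
    ι (m + m) ℚ.+ ½ ℚ.* ε          ≤⟨ ℚ.+-monoˡ-≤ (½ ℚ.* ε) (ι-mono-≤ (ℕ.+-monoʳ-≤ m m≤C)) ⟩
    ι (m + (k + 1) C 2) ℚ.+ ½ ℚ.* ε
      <⟨ ℚ.+-monoʳ-< (ι (m + (k + 1) C 2)) (½ε<ε 0<ε) ⟩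
    ι (m + (k + 1) C 2) ℚ.+ ε      ≡⟨ cong (ℚ._+ ε) (ι-def (m + (k + 1) C 2)) ⟩
    + (m + (k + 1) C 2) / 1 ℚ.+ ε  ∎
  where
  open ℚ.≤-Reasoning
  instance
    n≢0 : NonZero n
    n≢0 = n∸1≢0⇒n≢0 n
  m≤C : m ≤ (k + 1) C 2
  m≤C = edges-≤-binomial k≤n
    (cubeRoot-≤ (ℚ.nonNegative⁻¹ _ {{ℚ.normalize-nonNeg (8 * m ^ 2) (n ∸ 1)}}) root r≤k k≤n (ℕ.>-nonZero⁻¹ n))
  ½ε<ε : ∀ {ε} → 0ℚ ℚ.< ε → ½ ℚ.* ε ℚ.< ε
  ½ε<ε {ε} 0<ε = subst (½ ℚ.* ε ℚ.<_) (ℚ.*-identityˡ ε)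
    (ℚ.*-monoˡ-<-pos ε {{ℚ.positive 0<ε}} {½} {1ℚ} (ℚ.*<* (ℤ.+<+ (ℕ.s≤s (ℕ.s≤s ℕ.z≤n)))))
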